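{- For every $n\geq0$, the map $\phi:\mathsf{Sh}_n\to\mathcal{I}_{n+1}(1234,1243)$ defined below is well defined (its image consists of involutions of $[n+1]$ avoiding both $1234$ and $1243$) and is a bijection.
   Context: A Schröder path of length $2n$ is a lattice path from $(0,0)$ to $(2n,0)$ with steps $\mathsf{h}=(2,0)$, $\mathsf{u}=(1,1)$, $\mathsf{d}=(1,-1)$ never going below the $x$-axis; it is symmetric if it is symmetric about the line $x=n$. $\mathsf{Sh}_n$ is the set of symmetric Schröder paths of length $2n$. Involutions, pattern avoidance and $\mathcal{I}_m(T)$ (involutions of $[m]$ avoiding every pattern in $T$) are as usual. The map $\phi$: given $p\in\mathsf{Sh}_n$ (as a word in $\mathsf{u},\mathsf{d},\mathsf{h}$), form the word $p'$ by appending a letter $\mathsf{h}$ at the end, replacing every factor $\mathsf{u}\mathsf{d}$ by a letter $\mathsf{r}$, and deleting all remaining $\mathsf{d}$'s; $p'=p_1\cdots p_{n+1}\in\{\mathsf{u},\mathsf{r},\mathsf{h}\}^{n+1}$. For $x\in\{\mathsf{h},\mathsf{r},\mathsf{u}\}$ let $A_x=\{i: p_i=x\}$. For each $x$, if $A_x=\{i_1<\dots<i_\ell\}$, set $\pi_{i_j}=i_{\ell+1-j}$ for $1\le j\le\ell$. Then $\phi(p)=\pi=\pi_1\cdots\pi_{n+1}$. -}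

module Defs where

open import Algebra.Definitions using (Involutive)
open import Data.Fin.Base as Fin using (Fin; opposite)
open import Data.Integer.Base as ℤ using (ℤ; +_; 0ℤ)
import Data.Integer.Properties as ℤ
open import Data.Integer.Tactic.RingSolver using (solve-∀)
open import Data.List.Base
  using (List; []; _∷_; _++_; [_]; map; reverse; foldl; filter; allFin; length; lookup)
open import Data.List.Membership.Propositional using (_∈_)
open import Data.List.Membership.Propositional.Properties using (∈-filter⁺; ∈-allFin)
open import Data.List.Relation.Unary.All using (All)
open import Data.List.Relation.Unary.Any using (index)
open import Data.Nat.Base as ℕ using (ℕ; suc)
import Data.Nat.Properties as ℕ
open import Data.Product.Base using (Σ-syntax; _×_; _,_; proj₁; proj₂)
open import Data.Vec.Base as Vec using (Vec)
open import Function.Base using (_on_)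
open import Function.Bundles using (_⇔_)
open import Relation.Binary.Core using (Rel)
open import Relation.Binary.Definitions using (DecidableEquality)
open import Relation.Binary.PropositionalEquality
  using (_≡_; refl; sym; trans; cong; _≗_; module ≡-Reasoning)
open import Relation.Nullary using (¬_; yes; no)

------------------------------------------------------------------------
-- Symmetric Schröder paths

data Step : Set where
  h u d : Step

Point : Set
Point = ℤ × ℤ

infixl 6 _▸_

_▸_ : Point → Step → Point
(x , y) ▸ h = x ℤ.+ + 2 , y
(x , y) ▸ u = x ℤ.+ + 1 , y ℤ.+ + 1
(x , y) ▸ d = x ℤ.+ + 1 , y ℤ.- + 1

origin : Point
origin = 0ℤ , 0ℤ

-- The lattice points visited, in order, including the starting point.
verticesFrom : Point → List Step → List Point
verticesFrom v []      = [ v ]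
verticesFrom v (s ∷ p) = v ∷ verticesFrom (v ▸ s) p

vertices : List Step → List Point
vertices = verticesFrom origin

endpoint : List Step → Point
endpoint = foldl _▸_ origin

-- The steps are straight segments, so it suffices that no vertex lies
-- below the x-axis.
IsSchröder : ℕ → List Step → Set
IsSchröder n p =
  endpoint p ≡ (+ (2 ℕ.* n) , 0ℤ) × All (λ v → 0ℤ ℤ.≤ proj₂ v) (vertices p)

-- Reflection in the line x = n.
mirror : ℕ → Point → Point
mirror n (x , y) = + (2 ℕ.* n) ℤ.- x , y

-- The mirror image of a path is traversed from right to left, hence the
-- reversal.
IsSymmetric : ℕ → List Step → Set
IsSymmetric n p = map (mirror n) (vertices p) ≡ reverse (vertices p)

Sh : ℕ → Set
Sh n = Σ[ p ∈ List Step ] (IsSchröder n p × IsSymmetric n p)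

_≈Sh_ : ∀ {n} → Rel (Sh n) _
_≈Sh_ = _≡_ on proj₁

------------------------------------------------------------------------
-- Pattern-avoiding involutions

-- A pattern is written in one-line notation, e.g. 1 ∷ 2 ∷ 4 ∷ 3 ∷ [];
-- only the relative order of its entries matters.
Pattern : Set
Pattern = List ℕ

-- An occurrence of τ in π is a choice of positions e₁ < e₂ < ⋯ at which
-- the values of π are in the same relative order as the entries of τ.
Contains : ∀ {m} → (Fin m → Fin m) → Pattern → Set
Contains {m} π τ =
  Σ[ e ∈ (Fin (length τ) → Fin m) ]
    (∀ {i j} → i Fin.< j → e i Fin.< e j) ×
    (∀ i j → lookup τ i ℕ.< lookup τ j ⇔ π (e i) Fin.< π (e j))

Avoids : ∀ {m} → (Fin m → Fin m) → Pattern → Set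
Avoids π τ = ¬ Contains π τ

-- Involutivity makes π bijective, so being a permutation is not a
-- separate condition.
Is𝓘 : ∀ m → List Pattern → (Fin m → Fin m) → Set
Is𝓘 m T π = Involutive _≡_ π × All (Avoids π) T

𝓘 : ℕ → List Pattern → Set
𝓘 m T = Σ[ π ∈ (Fin m → Fin m) ] Is𝓘 m T π

_≈𝓘_ : ∀ {m T} → Rel (𝓘 m T) _
_≈𝓘_ = _≗_ on proj₁

------------------------------------------------------------------------
-- The map φ

data Letter : Set where
  h r u : Letter

_≟_ : DecidableEquality Letter
h ≟ h = yes refl
h ≟ r = no λ ()
h ≟ u = no λ ()
r ≟ h = no λ ()
r ≟ r = yes refl
r ≟ u = no λ ()
u ≟ h = no λ ()
u ≟ r = no λ ()
u ≟ u = yes refl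

-- Replace every factor ud by r and delete all remaining d's.
contract : List Step → List Letter
contract []          = []
contract (h ∷ p)     = h ∷ contract p
contract (u ∷ d ∷ p) = r ∷ contract p
contract (u ∷ p)     = u ∷ contract p
contract (d ∷ p)     = contract p

letters : List Step → List Letter
letters p = contract (p ++ [ h ])

-- h and u raise x + y by 2 and d leaves it unchanged, while each h or u
-- contributes one letter; this gives length (letters p) = n + 1.
open ≡-Reasoning

coordSum : Point → ℤ
coordSum (x , y) = x ℤ.+ y

one-more : ∀ s k → (s ℤ.+ + 2) ℤ.+ + 2 ℤ.* k ≡ s ℤ.+ + 2 ℤ.* (+ 1 ℤ.+ k)
one-more = solve-∀

coordSum-▸h : ∀ v → coordSum (v ▸ h) ≡ coordSum v ℤ.+ + 2
coordSum-▸h (x , y) = lemma x y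
  where
  lemma : ∀ x y → (x ℤ.+ + 2) ℤ.+ y ≡ (x ℤ.+ y) ℤ.+ + 2
  lemma = solve-∀

coordSum-▸u : ∀ v → coordSum (v ▸ u) ≡ coordSum v ℤ.+ + 2
coordSum-▸u (x , y) = lemma x y
  where
  lemma : ∀ x y → (x ℤ.+ + 1) ℤ.+ (y ℤ.+ + 1) ≡ (x ℤ.+ y) ℤ.+ + 2
  lemma = solve-∀

coordSum-▸d : ∀ v → coordSum (v ▸ d) ≡ coordSum v
coordSum-▸d (x , y) = lemma x y
  where
  lemma : ∀ x y → (x ℤ.+ + 1) ℤ.+ (y ℤ.- + 1) ≡ x ℤ.+ y
  lemma = solve-∀

extend : ∀ {e t} s k → e ≡ t ℤ.+ + 2 ℤ.* + k → t ≡ s ℤ.+ + 2 →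
         e ≡ s ℤ.+ + 2 ℤ.* + suc k
extend s k refl refl = one-more s (+ k)

coordSum-foldl : ∀ v p →
  coordSum (foldl _▸_ v p) ≡ coordSum v ℤ.+ + 2 ℤ.* + length (contract p)
coordSum-foldl v [] = sym (ℤ.+-identityʳ _)
coordSum-foldl v (h ∷ p) =
  extend (coordSum v) (length (contract p)) (coordSum-foldl (v ▸ h) p) (coordSum-▸h v)
coordSum-foldl v (u ∷ d ∷ p) =
  extend (coordSum v) (length (contract p)) (coordSum-foldl (v ▸ u ▸ d) p)
    (trans (coordSum-▸d (v ▸ u)) (coordSum-▸u v))
coordSum-foldl v (u ∷ []) =
  extend (coordSum v) (length (contract [])) (coordSum-foldl (v ▸ u) []) (coordSum-▸u v)
coordSum-foldl v (u ∷ h ∷ p) =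
  extend (coordSum v) (length (contract (h ∷ p))) (coordSum-foldl (v ▸ u) (h ∷ p)) (coordSum-▸u v)
coordSum-foldl v (u ∷ u ∷ p) =
  extend (coordSum v) (length (contract (u ∷ p))) (coordSum-foldl (v ▸ u) (u ∷ p)) (coordSum-▸u v)
coordSum-foldl v (d ∷ p) =
  trans (coordSum-foldl (v ▸ d) p) (cong (ℤ._+ _) (coordSum-▸d v))

length-letters : ∀ p → length (letters p) ≡ suc (length (contract p))
length-letters []          = refl
length-letters (h ∷ p)     = cong suc (length-letters p)
length-letters (u ∷ d ∷ p) = cong suc (length-letters p)
length-letters (u ∷ [])    = refl
length-letters (u ∷ h ∷ p) = cong suc (length-letters (h ∷ p))
length-letters (u ∷ u ∷ p) = cong suc (length-letters (u ∷ p))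
length-letters (d ∷ p)     = length-letters p

letters-length : ∀ {n} (p : Sh n) → length (letters (proj₁ p)) ≡ suc n
letters-length {n} (p , (end , _) , _) =
  trans (length-letters p) (cong suc (ℕ.*-cancelˡ-≡ _ n 2 (ℤ.+-injective (begin
    + (2 ℕ.* k)              ≡⟨ ℤ.pos-* 2 k ⟩
    + 2 ℤ.* + k              ≡⟨ ℤ.+-identityˡ _ ⟨
    0ℤ ℤ.+ + 2 ℤ.* + k       ≡⟨ coordSum-foldl origin p ⟨
    coordSum (endpoint p)    ≡⟨ cong coordSum end ⟩
    + (2 ℕ.* n) ℤ.+ 0ℤ       ≡⟨ ℤ.+-identityʳ _ ⟩
    + (2 ℕ.* n)              ∎))))
  where
  k : ℕ
  k = length (contract p)

-- The word p′ = p₁ ⋯ pₙ₊₁.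
word : ∀ {n} → Sh n → Vec Letter (suc n)
word p = Vec.cast (letters-length p) (Vec.fromList (letters (proj₁ p)))

-- The set A_x, listed in increasing order.
positions : ∀ {m} → Vec Letter m → Letter → List (Fin m)
positions c x = filter (λ i → Vec.lookup c i ≟ x) (allFin _)

self∈positions : ∀ {m} (c : Vec Letter m) i → i ∈ positions c (Vec.lookup c i)
self∈positions c i = ∈-filter⁺ (λ j → Vec.lookup c j ≟ Vec.lookup c i) (∈-allFin i) refl

-- Every i lies in exactly one A_x, with x the i-th letter; say i = i_j in
-- A_x = {i₁ < ⋯ < i_ℓ}.  As ‘opposite’ sends j to ℓ + 1 − j (when counting
-- from 1), the value at i is i_{ℓ+1−j}.
reverseClasses : ∀ {m} → Vec Letter m → Fin m → Fin m
reverseClasses c i =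
  lookup (positions c (Vec.lookup c i)) (opposite (index (self∈positions c i)))

φ : ∀ {n} → Sh n → Fin (suc n) → Fin (suc n)
φ p = reverseClasses (word p)

{-# OPTIONS --safe #-}

-- In an involution π avoiding 1234 and 1243, label a position i by the number
-- of points to the north-east of (i , π i): h for none, r for one, u for at
-- least two.  Avoidance makes the points of each label decreasing, and the
-- labels are invariant under transposition, so π reverses each label class and
-- is determined by its word of labels.  Conversely, reversing the classes of a
-- word c produces the labels c iff c ends in h, the rest v of c is a palindrome
-- after deleting its u's, and the j-th u of v has fewer letters h and r before
-- it than the j-th u from the right has after it.  These v are the contractions
-- of symmetric Schröder paths: the unmatched d-steps are the mirror images of
-- the unmatched u-steps, between consecutive h's and peaks they must precede the
-- u-steps (a ud would be a peak), and the last condition says that the resulting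
-- path does not go below the x-axis.

module Submission where

open import Defs
open import Algebra.Definitions using (Involutive)
open import Data.Bool.Base using (true; false)
open import Data.Empty using (⊥)
open import Data.Fin.Base as Fin using (Fin; zero; suc; toℕ; opposite)
open import Data.Fin.Patterns using (0F; 1F; 2F; 3F)
import Data.Fin.Properties as Fin
open import Data.Integer.Base as ℤ using (ℤ; 0ℤ) renaming (+_ to pos)
import Data.Integer.Properties as ℤ
open import Data.Integer.Tactic.RingSolver using (solve-∀)
open import Data.List.Base
  using (List; []; _∷_; _++_; [_]; _∷ʳ_; map; reverse; length; filter; foldl; tabulate; allFin;
         lookup; InitLast; initLast; _∷ʳ′_)
open import Data.List.Membership.Propositional.Properties using (∈-filter⁻; ∈-lookup)
open import Data.List.Properties
  using (∷-injective; ∷-injectiveˡ; ∷-injectiveʳ; ∷ʳ-injective; ∷ʳ-injectiveˡ; ∷ʳ-injectiveʳ;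
         ++-assoc; ++-identityʳ; filter-++; filter-accept; filter-reject; foldl-∷ʳ;
         length-++; length-map; length-reverse; map-++; map-tabulate;
         reverse-++; reverse-involutive; reverse-map; unfold-reverse)
open import Data.List.Relation.Unary.All using (All; []; _∷_)
open import Data.List.Relation.Unary.All.Properties using (all-filter)
open import Data.List.Relation.Unary.Any using (index)
open import Data.List.Relation.Unary.Any.Properties using (lookup-index)
open import Data.Nat.Base as ℕ using (ℕ; zero; suc; _+_; _∸_; _≤_; _<_; z≤n; s≤s; z<s; s<s)
open import Data.Nat.Properties as ℕ using (+-suc; +-comm; suc-injective)
open import Data.Product.Base using (Σ-syntax; ∃; ∃₂; _×_; _,_; proj₁; proj₂)
open import Data.Sum.Base as Sum using (_⊎_; inj₁; inj₂)
open import Data.Unit.Base using (⊤; tt)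
open import Data.Vec.Base as Vec using (Vec; []; _∷_; toList)
import Data.Vec.Properties as Vec
open import Function.Base using (_∘_; id)
open import Function.Bundles using (mk⇔; module Equivalence)
open import Function.Definitions using (Surjective; Bijective)
open import Level using (Level)
open import Relation.Binary.Definitions using (tri<; tri≈; tri>)
open import Relation.Binary.PropositionalEquality
  using (_≡_; _≢_; _≗_; refl; sym; trans; cong; cong₂; subst; subst₂; module ≡-Reasoning)
open import Relation.Nullary
  using (¬_; Dec; yes; no; does; contradiction; decidable-stable; ¬?; _×-dec_)
open import Relation.Unary using (Pred; Decidable)
import Algebra.Properties.AbelianGroup ℤ.+-0-abelianGroup as ℤ-group

-- Labels and words are linked by a count. If σ reverses the class of x and i lies outside it, the
-- x's to the right of i form a final segment of the class and those with values above `σ i` an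
-- initial one. So the number of x's north-east of i is the excess of the x's after i over the x's
-- before `σ i`, if positive. An r needs an excess of exactly one h; a u needs two h's, or an h and
-- an r, because above every r there is an h. The appended h is the label of the last position and
-- adds one to each number of h's after i: once it is removed, excess one becomes equality, whence
-- the palindrome. Accordingly, a letter is addressed by the number of equal letters before it
-- rather than by its index in `positions`.

private variable
  ℓ₀ : Level
  A B : Set
  m n : ℕ
  x y : Letter
  v w : List Letter
  p q : List Step

-- Prefixes, reversal and filtering of lists

++-longer : ∀ (as : List A) {bs} cs {ds} → as ++ bs ≡ cs ++ ds → length as ≤ length cs →
            ∃ λ es → cs ≡ as ++ es
++-longer []       cs       eq _         = cs , refl
++-longer (a ∷ as) (c ∷ cs) eq (s≤s as≤cs) with ∷-injective eq
... | refl , eq′ with ++-longer as cs eq′ as≤cs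
... | es , refl = es , refl

map-involutive : ∀ {f : A → A} → Involutive _≡_ f → Involutive _≡_ (map f)
map-involutive inv []       = refl
map-involutive inv (a ∷ as) = cong₂ _∷_ (inv a) (map-involutive inv as)

reverse-split : ∀ (as : List A) a bs → reverse (as ++ a ∷ bs) ≡ reverse bs ++ a ∷ reverse as
reverse-split as a bs = begin
  reverse (as ++ a ∷ bs)              ≡⟨ reverse-++ as (a ∷ bs) ⟩
  reverse (a ∷ bs) ++ reverse as      ≡⟨ cong (_++ reverse as) (unfold-reverse a bs) ⟩
  (reverse bs ++ [ a ]) ++ reverse as ≡⟨ ++-assoc (reverse bs) [ a ] (reverse as) ⟩
  reverse bs ++ a ∷ reverse as        ∎
  where open ≡-Reasoning

filter-map : ∀ {P : Pred B ℓ₀} (P? : Decidable P) (f : A → B) as →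
             filter P? (map f as) ≡ map f (filter (P? ∘ f) as)
filter-map P? f []       = refl
filter-map P? f (a ∷ as) with does (P? (f a))
... | true  = cong (f a ∷_) (filter-map P? f as)
... | false = filter-map P? f as

filter-reverse : ∀ {P : Pred A ℓ₀} (P? : Decidable P) as →
                 filter P? (reverse as) ≡ reverse (filter P? as)
filter-reverse P? []       = refl
filter-reverse P? (a ∷ as)
  rewrite unfold-reverse a as | filter-++ P? (reverse as) [ a ] | filter-reverse P? as
  with does (P? a)
... | true  = sym (unfold-reverse a (filter P? as))
... | false = ++-identityʳ (reverse (filter P? as))

-- Counting the occurrences of a letter

opaque
  -- Opaque, so that `count x w` does not unfold to a filter and unification can read off `x` and
  -- `w`.
  count : Letter → List Letter → ℕ
  count x w = length (filter (_≟ x) w)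

  count-++ : ∀ x v {w} → count x (v ++ w) ≡ count x v + count x w
  count-++ x v {w} = trans (cong length (filter-++ (_≟ x) v w)) (length-++ (filter (_≟ x) v))

  count-here : ∀ x {w} → count x (x ∷ w) ≡ suc (count x w)
  count-here x = cong length (filter-accept (_≟ x) refl)

  count-nil : ∀ x → count x [] ≡ 0
  count-nil x = refl

  count-other : ∀ {x y w} → y ≢ x → count x (y ∷ w) ≡ count x w
  count-other y≢x = cong length (filter-reject (_≟ _) y≢x)

  count-∷ : ∀ x y {w} → count x (y ∷ w) ≡ count x [ y ] + count x w
  count-∷ x y = count-++ x [ y ]

  count-split : ∀ x v {w} → count x (v ++ x ∷ w) ≡ suc (count x v + count x w)
  count-split x v {w} = trans (count-++ x v) (trans (cong (count x v +_) (count-here x)) (+-suc _ _))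

  count-reverse : ∀ x w → count x (reverse w) ≡ count x w
  count-reverse x w = trans (cong length (filter-reverse (_≟ x) w)) (length-reverse (filter (_≟ x) w))

find-split : ∀ x w {k} → k < count x w → ∃₂ λ α β → w ≡ α ++ x ∷ β × count x α ≡ k
find-split x [] k< = contradiction (subst (_ <_) (count-nil x) k<) λ ()
find-split x (y ∷ w) {k} k< with y ≟ x
find-split x (x ∷ w) {zero}  _  | yes refl = [] , w , refl , count-nil x
find-split x (x ∷ w) {suc k} k< | yes refl
  with α , β , refl , refl ← find-split x w (ℕ.s<s⁻¹ (subst (suc k <_) (count-here x) k<)) =
  x ∷ α , β , refl , count-here x
find-split x (y ∷ w) {k} k< | no y≢x
  with α , β , refl , eq ← find-split x w (subst (k <_) (count-other y≢x) k<) =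
  y ∷ α , β , refl , trans (count-other y≢x) eq

-- With `find-split`, this makes the number of preceding x's an address for the occurrences of x.
split-unique : ∀ x α {β} α′ {β′} → α ++ x ∷ β ≡ α′ ++ x ∷ β′ → count x α ≡ count x α′ →
               α ≡ α′ × β ≡ β′
split-unique x []      []       eq _ = refl , proj₂ (∷-injective eq)
split-unique x []      (y ∷ α′) eq c with refl ← proj₁ (∷-injective eq) =
  contradiction (trans (sym (count-nil x)) (trans c (count-here x))) λ ()
split-unique x (y ∷ α) []       eq c with refl ← proj₁ (∷-injective eq) =
  contradiction (trans (sym (count-nil x)) (trans (sym c) (count-here x))) λ ()
split-unique x (y ∷ α) (z ∷ α′) eq c with ∷-injective eq
... | refl , eq′ with split-unique x α α′ eq′
                        -- The common first letter contributes the same amount to both counts,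
                        -- whether or not it is x.
                        (ℕ.+-cancelˡ-≡ (count x [ y ]) _ _ (trans (sym (count-∷ x y)) (trans c (count-∷ x y))))
... | refl , refl = refl , refl

-- Positions in a word

before after : Vec Letter m → Fin m → List Letter
before (x ∷ c) zero    = []
before (x ∷ c) (suc i) = x ∷ before c i
after  (x ∷ c) zero    = toList c
after  (x ∷ c) (suc i) = after c i

toList-split : ∀ (c : Vec Letter m) i → toList c ≡ before c i ++ Vec.lookup c i ∷ after c i
toList-split (x ∷ c) zero    = refl
toList-split (x ∷ c) (suc i) = cong (x ∷_) (toList-split c i)

record At (c : Vec Letter m) (x : Letter) (α β : List Letter) (i : Fin m) : Set where
  constructor at
  field
    letter : Vec.lookup c i ≡ x
    prefix : before c i ≡ α
    suffix : after c i ≡ β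

position : ∀ (c : Vec Letter m) α {β} → toList c ≡ α ++ x ∷ β → ∃ (At c x α β)
position (y ∷ c) []      eq with refl , refl ← ∷-injective eq = zero , at refl refl refl
position (y ∷ c) (z ∷ α) eq with ∷-injective eq
... | refl , eq′ with position c α eq′
... | i , at refl refl refl = suc i , at refl refl refl

-- γ is the part strictly between i and j; the monotonicity of all counts comes from it.
split-< : ∀ (c : Vec Letter m) {i j} → i Fin.< j → ∃ λ γ →
          before c j ≡ before c i ++ Vec.lookup c i ∷ γ ×
          after c i ≡ γ ++ Vec.lookup c j ∷ after c j
split-< (x ∷ c) {zero}  {suc j} _       = before c j , refl , toList-split c j
split-< (x ∷ c) {suc i} {suc j} (s<s i<j) with split-< c i<j
... | γ , p , q = γ , cong (x ∷_) p , q

module _ (c : Vec Letter m) where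

  private
    b a : Letter → Fin m → ℕ
    b x i = count x (before c i)
    a x i = count x (after c i)

  count-at : ∀ {i} → Vec.lookup c i ≡ x → count x (toList c) ≡ suc (b x i + a x i)
  count-at {x = x} {i} refl = trans (cong (count x) (toList-split c i)) (count-split x (before c i))

  before-< : ∀ {i j} → Vec.lookup c i ≡ x → i Fin.< j → b x i < b x j
  before-< {x = x} {i} refl i<j with γ , p , _ ← split-< c i<j =
    ℕ.≤-trans (s≤s (ℕ.m≤m+n _ _)) (ℕ.≤-reflexive (sym (trans (cong (count x) p) (count-split x (before c i)))))

  before-≤ : ∀ x {i j} → i Fin.≤ j → b x i ≤ b x j
  before-≤ x {i} {j} i≤j with Fin.<-cmp i j
  ... | tri≈ _ refl _ = ℕ.≤-refl
  ... | tri> _ _ j<i  = contradiction i≤j (ℕ.<⇒≱ j<i)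
  ... | tri< i<j _ _ with γ , p , _ ← split-< c i<j =
    ℕ.≤-trans (ℕ.m≤m+n _ _) (ℕ.≤-reflexive (sym (trans (cong (count x) p) (count-++ x (before c i)))))

  after-< : ∀ {i j} → Vec.lookup c j ≡ x → i Fin.< j → a x j < a x i
  after-< {x = x} {i} {j} refl i<j with γ , _ , p ← split-< c i<j =
    ℕ.≤-trans (s≤s (ℕ.m≤n+m _ (count x γ))) (ℕ.≤-reflexive (sym (trans (cong (count x) p) (count-split x γ))))

  after-≤ : ∀ x {i j} → i Fin.≤ j → a x j ≤ a x i
  after-≤ x {i} {j} i≤j with Fin.<-cmp i j
  ... | tri≈ _ refl _ = ℕ.≤-refl
  ... | tri> _ _ j<i  = contradiction i≤j (ℕ.<⇒≱ j<i)
  ... | tri< i<j _ _ with γ , _ , p ← split-< c i<j = begin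
    a x j                                      ≤⟨ ℕ.m≤n+m _ _ ⟩
    count x [ Vec.lookup c j ] + a x j         ≡⟨ count-∷ x (Vec.lookup c j) ⟨
    count x (Vec.lookup c j ∷ after c j)       ≤⟨ ℕ.m≤n+m _ (count x γ) ⟩
    count x γ + count x (Vec.lookup c j ∷ after c j)
                                               ≡⟨ count-++ x γ ⟨
    count x (γ ++ Vec.lookup c j ∷ after c j)  ≡⟨ cong (count x) p ⟨
    a x i                                      ∎
    where open ℕ.≤-Reasoning

  after-≤-total : ∀ x i → a x i ≤ count x (toList c)
  after-≤-total x i = begin
    a x i                                              ≤⟨ ℕ.m≤n+m _ _ ⟩
    count x [ Vec.lookup c i ] + a x i                 ≡⟨ count-∷ x (Vec.lookup c i) ⟨
    count x (Vec.lookup c i ∷ after c i)               ≤⟨ ℕ.m≤n+m _ (b x i) ⟩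
    b x i + count x (Vec.lookup c i ∷ after c i)       ≡⟨ count-++ x (before c i) ⟨
    count x (before c i ++ Vec.lookup c i ∷ after c i) ≡⟨ cong (count x) (toList-split c i) ⟨
    count x (toList c)                                 ∎
    where open ℕ.≤-Reasoning

  before-injective : ∀ {i j} → Vec.lookup c i ≡ x → Vec.lookup c j ≡ x → b x i ≡ b x j → i ≡ j
  before-injective {i = i} {j} ci cj eq with Fin.<-cmp i j
  ... | tri< i<j _ _ = contradiction eq (ℕ.<⇒≢ (before-< ci i<j))
  ... | tri≈ _ i≡j _ = i≡j
  ... | tri> _ _ j<i = contradiction (sym eq) (ℕ.<⇒≢ (before-< cj j<i))

  find-position : ∀ x {k} → k < count x (toList c) → ∃ λ i → Vec.lookup c i ≡ x × b x i ≡ k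
  find-position x k< with α , β , eq , refl ← find-split x (toList c) k<
    with i , at ci refl refl ← position c α eq = i , ci , refl

-- Reversing every class

-- The tail of `allFin (suc m)` is `tabulate suc`; this reads its filtered form as the class of the
-- shorter word, shifted by one.
positions-suc : ∀ (c : Vec Letter m) x y →
  filter (λ i → Vec.lookup (y ∷ c) i ≟ x) (tabulate suc) ≡ map suc (positions c x)
positions-suc c x y =
  trans (cong (filter is-x?) (sym (map-tabulate id suc))) (filter-map is-x? suc (allFin _))
  where
  is-x? : Decidable (λ i → Vec.lookup (y ∷ c) i ≡ x)
  is-x? i = Vec.lookup (y ∷ c) i ≟ x

-- The two indices are compared through `toℕ`, since they live in `Fin` types over the lengths of
-- different lists.
lookup-map : ∀ (f : A → B) as i → ∃ λ j → toℕ j ≡ toℕ i × lookup (map f as) i ≡ f (lookup as j)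
lookup-map f (a ∷ as) zero    = zero , refl , refl
lookup-map f (a ∷ as) (suc i) with j , p , q ← lookup-map f as i = suc j , cong suc p , q

before-positions : ∀ (c : Vec Letter m) x j → count x (before c (lookup (positions c x) j)) ≡ toℕ j
before-positions (y ∷ c) x j with y ≟ x
before-positions (x ∷ c) x zero    | yes refl = count-nil x
before-positions (x ∷ c) x (suc j) | yes refl
  rewrite positions-suc c x x with lookup-map suc (positions c x) j
... | k , p , q rewrite q = trans (count-here x) (cong suc (trans (before-positions c x k) p))
before-positions (y ∷ c) x j | no y≢x
  rewrite positions-suc c x y with lookup-map suc (positions c x) j
... | k , p , q rewrite q = trans (count-other y≢x) (trans (before-positions c x k) p)

length-positions : ∀ (c : Vec Letter m) x → length (positions c x) ≡ count x (toList c)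
length-positions []      x = sym (count-nil x)
length-positions (y ∷ c) x with y ≟ x
... | yes refl rewrite positions-suc c x y =
  trans (cong suc (trans (length-map suc (positions c x)) (length-positions c x))) (sym (count-here x))
... | no y≢x rewrite positions-suc c x y =
  trans (trans (length-map suc (positions c x)) (length-positions c x)) (sym (count-other y≢x))

-- Reversing a class expressed by counts alone. It determines σ without mentioning `reverseClasses`,
-- so it can also be proved for an arbitrary involution.
record Reversal (c : Vec Letter m) (σ : Fin m → Fin m) : Set where
  field
    keeps : ∀ i → Vec.lookup c (σ i) ≡ Vec.lookup c i
    flips : ∀ {i} → Vec.lookup c i ≡ x → count x (before c (σ i)) ≡ count x (after c i)

  flips′ : ∀ {i} → Vec.lookup c i ≡ x → count x (after c (σ i)) ≡ count x (before c i)
  flips′ {x = x} {i} ci = ℕ.+-cancelˡ-≡ (count x (after c i)) _ _ (suc-injective (begin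
    suc (count x (after c i) + count x (after c (σ i)))      ≡⟨ cong (λ k → suc (k + count x (after c (σ i)))) (flips ci) ⟨
    suc (count x (before c (σ i)) + count x (after c (σ i))) ≡⟨ count-at c (trans (keeps i) ci) ⟨
    count x (toList c)                                       ≡⟨ count-at c ci ⟩
    suc (count x (before c i) + count x (after c i))         ≡⟨ cong suc (+-comm (count x (before c i)) _) ⟩
    suc (count x (after c i) + count x (before c i))         ∎))
    where open ≡-Reasoning

  involutive : ∀ i → σ (σ i) ≡ i
  involutive i = before-injective c (trans (keeps _) (keeps i)) refl
    (trans (flips (keeps i)) (flips′ refl))

Reversal-unique : ∀ {c : Vec Letter m} {σ τ} → Reversal c σ → Reversal c τ → σ ≗ τ
Reversal-unique {c = c} S T i = before-injective c (S.keeps i) (T.keeps i) (trans (S.flips refl) (sym (T.flips refl)))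
  where
  module S = Reversal S
  module T = Reversal T

-- The index j of i in its class is the number of equal letters before i, and `opposite j` is the
-- class size less `suc j`; what remains is the number of equal letters after i.
reverseClasses-reversal : ∀ (c : Vec Letter m) → Reversal c (reverseClasses c)
reverseClasses-reversal {m} c = record { keeps = keeps ; flips = λ { refl → flips _ } }
  where
  open ≡-Reasoning
  keeps : ∀ i → Vec.lookup c (reverseClasses c i) ≡ Vec.lookup c i
  keeps i = proj₂ (∈-filter⁻ (λ j → Vec.lookup c j ≟ Vec.lookup c i)
                    {xs = allFin m} (∈-lookup {xs = positions c _} _))
  flips : ∀ i → let x = Vec.lookup c i in
          count x (before c (reverseClasses c i)) ≡ count x (after c i)
  flips i = begin
    count x₀ (before c (lookup P (opposite j)))         ≡⟨ before-positions c x₀ (opposite j) ⟩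
    toℕ (opposite j)                                    ≡⟨ Fin.opposite-prop j ⟩
    length P ∸ suc (toℕ j)
      ≡⟨ cong₂ (λ k l → k ∸ suc l) (length-positions c x₀) (sym (before-positions c x₀ j)) ⟩
    count x₀ (toList c) ∸ suc (count x₀ (before c (lookup P j)))
      ≡⟨ cong₂ (λ k l → k ∸ suc (count x₀ (before c l))) (count-at c refl) (sym (lookup-index (self∈positions c i))) ⟩
    suc (count x₀ (before c i) + count x₀ (after c i)) ∸ suc (count x₀ (before c i))
      ≡⟨ ℕ.m+n∸m≡n (count x₀ (before c i)) _ ⟩
    count x₀ (after c i)                                ∎
    where
    x₀ = Vec.lookup c i
    P  = positions c x₀
    j  = index (self∈positions c i)

-- Labels of an involution

-- The point (j , σ j) is to the north-east of (i , σ i).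
_⊢_◁_ : (Fin m → Fin m) → Fin m → Fin m → Set
σ ⊢ i ◁ j = i Fin.< j × σ i Fin.< σ j

_⊢_◁?_ : ∀ (σ : Fin m → Fin m) i j → Dec (σ ⊢ i ◁ j)
σ ⊢ i ◁? j = (i Fin.<? j) ×-dec (σ i Fin.<? σ j)

◁-trans : ∀ {σ : Fin m → Fin m} {i j k} → σ ⊢ i ◁ j → σ ⊢ j ◁ k → σ ⊢ i ◁ k
◁-trans (p , q) (p′ , q′) = ℕ.<-trans p p′ , ℕ.<-trans q q′

◁-irrefl : ∀ {σ : Fin m → Fin m} {i} → ¬ σ ⊢ i ◁ i
◁-irrefl (p , _) = ℕ.<-irrefl refl p

-- Witnesses replace the cardinality of the set of dominating points, of which only the values 0, 1
-- and at least 2 matter.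
data Label (σ : Fin m → Fin m) (i : Fin m) : Letter → Set where
  none : (∀ j → ¬ σ ⊢ i ◁ j) → Label σ i h
  one  : ∀ {j} → σ ⊢ i ◁ j → (∀ k → σ ⊢ i ◁ k → k ≡ j) → Label σ i r
  two  : ∀ {j k} → j ≢ k → σ ⊢ i ◁ j → σ ⊢ i ◁ k → Label σ i u

Label-unique : ∀ {σ : Fin m → Fin m} {i} → Label σ i x → Label σ i y → x ≡ y
Label-unique (none _)     (none _)      = refl
Label-unique (none p)     (one q _)     = contradiction q (p _)
Label-unique (none p)     (two _ q _)   = contradiction q (p _)
Label-unique (one q _)    (none p)      = contradiction q (p _)
Label-unique (one _ _)    (one _ _)     = refl
Label-unique (one _ f)    (two j≢k p q) = contradiction (trans (f _ p) (sym (f _ q))) j≢k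
Label-unique (two _ q _)  (none p)      = contradiction q (p _)
Label-unique (two j≢k p q) (one _ f)    = contradiction (trans (f _ p) (sym (f _ q))) j≢k
Label-unique (two _ _ _)  (two _ _ _)   = refl

label : ∀ (σ : Fin m → Fin m) i → ∃ (Label σ i)
label σ i with Fin.any? (σ ⊢ i ◁?_)
... | no none-above = h , none λ j i◁j → none-above (j , i◁j)
... | yes (j , i◁j) with Fin.any? (λ k → ¬? (j Fin.≟ k) ×-dec (σ ⊢ i ◁? k))
...   | yes (k , j≢k , i◁k) = u , two j≢k i◁j i◁k
...   | no no-other = r , one i◁j λ k i◁k →
          sym (decidable-stable (j Fin.≟ k) λ j≢k → no-other (k , j≢k , i◁k))

Labelling : Vec Letter m → (Fin m → Fin m) → Set
Labelling c σ = ∀ i → Label σ i (Vec.lookup c i)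

-- A fork is an occurrence of 1234 or 1243.
Forkless : (Fin m → Fin m) → Set
Forkless σ = ∀ {i j k l} → σ ⊢ i ◁ j → k ≢ l → σ ⊢ j ◁ k → σ ⊢ j ◁ l → ⊥

-- Pattern occurrences and forks

Increasing : (Fin m → Fin n) → Set
Increasing f = ∀ {i j} → i Fin.< j → f i Fin.< f j

increasing₄ : ∀ {a b c e : Fin m} → a Fin.< b → b Fin.< c → c Fin.< e →
              Increasing (Vec.lookup (a ∷ b ∷ c ∷ e ∷ []))
increasing₄ p q s {0F} {1F} _ = p
increasing₄ p q s {0F} {2F} _ = ℕ.<-trans p q
increasing₄ p q s {0F} {3F} _ = ℕ.<-trans p (ℕ.<-trans q s)
increasing₄ p q s {1F} {2F} _ = q
increasing₄ p q s {1F} {3F} _ = ℕ.<-trans q s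
increasing₄ p q s {2F} {3F} _ = s
increasing₄ p q s {suc i} {1F} (s<s ())
increasing₄ p q s {suc (suc i)} {2F} (s<s (s<s ()))
increasing₄ p q s {3F} {3F} (s<s (s<s (s<s ())))

increasing-reflects : ∀ {f : Fin m → Fin n} → Increasing f → ∀ {i j} → f i Fin.< f j → i Fin.< j
increasing-reflects f↑ {i} {j} fi<fj with Fin.<-cmp i j
... | tri< i<j _ _  = i<j
... | tri≈ _ refl _ = contradiction fi<fj (ℕ.<-irrefl refl)
... | tri> _ _ j<i  = contradiction fi<fj (ℕ.<-asym (f↑ j<i))

-- `v` lists the values in increasing order and `rank i` is the place there of the i-th one, so
-- entries of τ and values of σ are both compared by rank. The `suc` is there because patterns count
-- from 1.
occurrence : ∀ {σ : Fin m → Fin m} τ {e : Fin (length τ) → Fin m} {v : Fin n → Fin m}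
             (rank : Fin (length τ) → Fin n) → Increasing e → Increasing v →
             (∀ i → lookup τ i ≡ suc (toℕ (rank i))) → (∀ i → σ (e i) ≡ v (rank i)) → Contains σ τ
occurrence {σ = σ} τ {e} {v} rank e↑ v↑ τ≡ σe≡ = e , e↑ , λ i j → mk⇔
  (λ τi<τj → subst₂ Fin._<_ (sym (σe≡ i)) (sym (σe≡ j))
               (v↑ (ℕ.s<s⁻¹ (subst₂ _<_ (τ≡ i) (τ≡ j) τi<τj))))
  (λ σi<σj → subst₂ _<_ (sym (τ≡ i)) (sym (τ≡ j))
               (s<s (increasing-reflects v↑ (subst₂ Fin._<_ (σe≡ i) (σe≡ j) σi<σj))))

1234-pattern 1243-pattern : Pattern
1234-pattern = 1 ∷ 2 ∷ 3 ∷ 4 ∷ []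
1243-pattern = 1 ∷ 2 ∷ 4 ∷ 3 ∷ []

involutive⇒injective : ∀ {σ : Fin m → Fin m} → Involutive _≡_ σ → ∀ {i j} → σ i ≡ σ j → i ≡ j
involutive⇒injective {σ = σ} inv {i} {j} eq = trans (sym (inv i)) (trans (cong σ eq) (inv j))

-- The order of the two upper values decides between 1234 and 1243; injectivity of σ excludes a tie.
avoids⇒forkless : ∀ {σ : Fin m → Fin m} → Involutive _≡_ σ →
                  All (Avoids σ) (1234-pattern ∷ 1243-pattern ∷ []) → Forkless σ
avoids⇒forkless {σ = σ} inv (¬1234 ∷ ¬1243 ∷ []) = fork
  where
  ordered : ∀ {i j k l} → σ ⊢ i ◁ j → k Fin.< l → σ ⊢ j ◁ k → σ ⊢ j ◁ l → ⊥
  ordered {i} {j} {k} {l} (i<j , σi<σj) k<l (j<k , σj<σk) (j<l , σj<σl) with Fin.<-cmp (σ k) (σ l)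
  ... | tri< σk<σl _ _ = ¬1234 (occurrence 1234-pattern id
          (increasing₄ i<j j<k k<l) (increasing₄ σi<σj σj<σk σk<σl)
          (λ { 0F → refl ; 1F → refl ; 2F → refl ; 3F → refl })
          (λ { 0F → refl ; 1F → refl ; 2F → refl ; 3F → refl }))
  ... | tri≈ _ σk≡σl _ = contradiction (cong toℕ (involutive⇒injective inv σk≡σl)) (ℕ.<⇒≢ k<l)
  ... | tri> _ _ σl<σk = ¬1243 (occurrence 1243-pattern (Vec.lookup (0F ∷ 1F ∷ 3F ∷ 2F ∷ []))
          (increasing₄ i<j j<k k<l) (increasing₄ σi<σj σj<σl σl<σk)
          (λ { 0F → refl ; 1F → refl ; 2F → refl ; 3F → refl })
          (λ { 0F → refl ; 1F → refl ; 2F → refl ; 3F → refl }))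
  fork : Forkless σ
  fork {k = k} {l} i◁j k≢l j◁k j◁l with Fin.<-cmp k l
  ... | tri< k<l _ _ = ordered i◁j k<l j◁k j◁l
  ... | tri≈ _ k≡l _ = k≢l k≡l
  ... | tri> _ _ l<k = ordered i◁j l<k j◁l j◁k

-- The patterns differ only in the order of their last two values, which `fork′` never compares.
forkless⇒avoids : ∀ {σ : Fin m → Fin m} → Forkless σ → All (Avoids σ) (1234-pattern ∷ 1243-pattern ∷ [])
forkless⇒avoids {σ = σ} fork =
  (λ (e , e↑ , iff) → fork′ e e↑ (to (iff 0F 1F) (s<s z<s)) (to (iff 1F 2F) (s<s (s<s z<s)))
                                 (to (iff 1F 3F) (s<s (s<s z<s)))) ∷
  (λ (e , e↑ , iff) → fork′ e e↑ (to (iff 0F 1F) (s<s z<s)) (to (iff 1F 2F) (s<s (s<s z<s)))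
                                 (to (iff 1F 3F) (s<s (s<s z<s)))) ∷ []
  where
  open Equivalence using (to)
  fork′ : ∀ (e : Fin 4 → Fin _) → Increasing e → σ (e 0F) Fin.< σ (e 1F) →
          σ (e 1F) Fin.< σ (e 2F) → σ (e 1F) Fin.< σ (e 3F) → ⊥
  fork′ e e↑ p q s = fork (e↑ z<s , p) (λ e₂≡e₃ → ℕ.<⇒≢ (e↑ {2F} {3F} (s<s (s<s z<s))) (cong toℕ e₂≡e₃))
                          (e↑ (s<s z<s) , q) (e↑ (s<s z<s) , s)

-- Domination in the reversal of a word

module _ {c : Vec Letter m} {σ : Fin m → Fin m} (R : Reversal c σ) where

  open Reversal R

  private
    b a : Letter → Fin m → ℕ
    b x i = count x (before c i)
    a x i = count x (after c i)

  dominated⇒ : ∀ {i j} → σ ⊢ i ◁ j → Vec.lookup c j ≡ x → b x (σ i) < a x i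
  dominated⇒ {x = x} {i} {j} (i<j , σi<σj) cj = begin-strict
    b x (σ i) ≤⟨ before-≤ c x (ℕ.<⇒≤ σi<σj) ⟩
    b x (σ j) ≡⟨ flips cj ⟩
    a x j     <⟨ after-< c cj i<j ⟩
    a x i     ∎
    where open ℕ.≤-Reasoning

  private
    -- j comes first and k, being later in its class, has the smaller value: `i < j` puts both
    -- points to the right of i, and `σ i < σ k` puts both above it.
    ordered : ∀ {i j k} → j Fin.< k → i Fin.< j → σ i Fin.< σ k →
              Vec.lookup c j ≡ x → Vec.lookup c k ≡ x → suc (b x (σ i)) < a x i
    ordered {x = x} {i} {j} {k} j<k i<j σi<σk cj ck = begin-strict
      suc (b x (σ i)) ≤⟨ s≤s (before-≤ c x (ℕ.<⇒≤ σi<σk)) ⟩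
      suc (b x (σ k)) ≡⟨ cong suc (flips ck) ⟩
      suc (a x k)     ≤⟨ after-< c ck j<k ⟩
      a x j           <⟨ after-< c cj i<j ⟩
      a x i           ∎
      where open ℕ.≤-Reasoning

  doubly-dominated⇒ : ∀ {i j k} → j ≢ k → σ ⊢ i ◁ j → σ ⊢ i ◁ k →
                      Vec.lookup c j ≡ x → Vec.lookup c k ≡ x → suc (b x (σ i)) < a x i
  doubly-dominated⇒ {x = x} {i} {j} {k} j≢k i◁j i◁k cj ck with Fin.<-cmp j k
  ... | tri< j<k _ _ = ordered j<k (proj₁ i◁j) (proj₂ i◁k) cj ck
  ... | tri≈ _ j≡k _ = contradiction j≡k j≢k
  ... | tri> _ _ k<j = ordered k<j (proj₁ i◁k) (proj₂ i◁j) ck cj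

  same-letter⇒¬◁ : ∀ {i j} → Vec.lookup c i ≡ x → Vec.lookup c j ≡ x → ¬ σ ⊢ i ◁ j
  same-letter⇒¬◁ ci cj i◁j = ℕ.<⇒≢ (dominated⇒ i◁j cj) (flips ci)

  -- The witness is the image of the x with k x's before it, so it has k x's after it. The two
  -- bounds on k put it to the right of i and above it. Distinct k give distinct witnesses, which is
  -- why the last component is kept.
  dominator : ∀ {i k} → Vec.lookup c i ≢ x → b x (σ i) ≤ k → k < a x i →
              ∃ λ j → Vec.lookup c j ≡ x × σ ⊢ i ◁ j × a x j ≡ k
  dominator {x = x} {i} {k} ci≢x b≤k k<a
    with j , cj , bj ← find-position c x (ℕ.≤-trans k<a (after-≤-total c x i)) =
    σ j , trans (keeps j) cj , (i<σj , subst (σ i Fin.<_) (sym (involutive j)) σi<j) , aσj≡k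
    where
    aσj≡k : a x (σ j) ≡ k
    aσj≡k = trans (flips′ cj) bj
    i<σj : i Fin.< σ j
    i<σj = ℕ.≰⇒> λ σj≤i → ℕ.<⇒≱ k<a (ℕ.≤-trans (after-≤ c x σj≤i) (ℕ.≤-reflexive aσj≡k))
    σi<j : σ i Fin.< j
    σi<j with Fin.<-cmp (σ i) j
    ... | tri< σi<j _ _ = σi<j
    ... | tri≈ _ refl _ = contradiction (trans (sym (keeps i)) cj) ci≢x
    ... | tri> _ _ j<σi = contradiction (ℕ.≤-trans (s≤s (ℕ.≤-reflexive (sym bj))) (before-< c cj j<σi)) (ℕ.≤⇒≯ b≤k)

  -- The two lower points of a fork would both be labelled u, and no letter of a reversal dominates
  -- an equal one.
  labelling⇒forkless : Labelling c σ → Forkless σ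
  labelling⇒forkless ℓ {i} {j} {k} i◁j k≢l j◁k j◁l = same-letter⇒¬◁
    (Label-unique (ℓ i) (two (λ { refl → ◁-irrefl {σ = σ} j◁k }) i◁j (◁-trans {σ = σ} i◁j j◁k)))
    (Label-unique (ℓ j) (two k≢l j◁k j◁l)) i◁j

-- In a reversal, a point i has a dominating point of another class x iff
-- more x's come after i than before σ i; this expresses a labelling by counts.
record Admissible (c : Vec Letter m) (σ : Fin m → Fin m) : Set where
  field
    r-count : ∀ {i} → Vec.lookup c i ≡ r → count h (after c i) ≡ suc (count h (before c (σ i)))
    u-count : ∀ {i} → Vec.lookup c i ≡ u →
      suc (count h (before c (σ i))) < count h (after c i) ⊎
      (count h (before c (σ i)) < count h (after c i) × count r (before c (σ i)) < count r (after c i))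

module _ {c : Vec Letter m} {σ : Fin m → Fin m} (R : Reversal c σ) where

  open Reversal R

  private
    b a : Letter → Fin m → ℕ
    b x i = count x (before c i)
    a x i = count x (after c i)

  labelling⇒admissible : Labelling c σ → Admissible c σ
  labelling⇒admissible ℓ = record { r-count = r-count ; u-count = u-count }
    where
    labelled : ∀ {i} → Vec.lookup c i ≡ x → Label σ i x
    labelled {i = i} ci = subst (Label σ i) ci (ℓ i)

    not-dominated : ∀ {i j} → (∀ k → σ ⊢ i ◁ k → k ≡ j) → σ ⊢ i ◁ j → ∀ {k} → ¬ σ ⊢ j ◁ k
    not-dominated {j = j} only i◁j {k} j◁k =
      ◁-irrefl {σ = σ} (subst (σ ⊢ j ◁_) (only k (◁-trans {σ = σ} i◁j j◁k)) j◁k)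

    -- Whatever dominates the sole dominator of i dominates i as well; hence that dominator is
    -- maximal and labelled h.
    r-dominator : ∀ {i} → Vec.lookup c i ≡ r →
                  ∃ λ j → Vec.lookup c j ≡ h × σ ⊢ i ◁ j × (∀ k → σ ⊢ i ◁ k → k ≡ j)
    r-dominator ci with labelled ci
    ... | one {j} i◁j only with Vec.lookup c j in cj
    ... | h = j , cj , i◁j , only
    ... | r with labelled cj
    ...   | one j◁k _ = contradiction j◁k (not-dominated only i◁j)
    r-dominator ci | one {j} i◁j only | u with labelled cj
    ...   | two _ j◁k _ = contradiction j◁k (not-dominated only i◁j)

    h<-of-◁ : ∀ {i j} → Vec.lookup c i ≡ u → σ ⊢ i ◁ j → b h (σ i) < a h i
    h<-of-◁ {j = j} ci i◁j with Vec.lookup c j in cj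
    ... | h = dominated⇒ R i◁j cj
    ... | u = contradiction i◁j (same-letter⇒¬◁ R ci cj)
    -- An r is itself dominated by an h, which then dominates i.
    ... | r with k , ck , j◁k , _ ← r-dominator cj = dominated⇒ R (◁-trans {σ = σ} i◁j j◁k) ck

    r-count : ∀ {i} → Vec.lookup c i ≡ r → a h i ≡ suc (b h (σ i))
    r-count {i} ci with j , cj , i◁j , only ← r-dominator ci = ℕ.≤-antisym (ℕ.≮⇒≥ not-two) (dominated⇒ R i◁j cj)
      where
      ci≢h : Vec.lookup c i ≢ h
      ci≢h ci′ with () ← trans (sym ci) ci′
      not-two : ¬ suc (b h (σ i)) < a h i
      not-two bi<ai =
        -- An excess of two gives dominating h's with different numbers of h's after them, which
        -- `only` would identify.
        let k , _ , i◁k , ak = dominator R ci≢h ℕ.≤-refl (ℕ.<⇒≤ bi<ai)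
            l , _ , i◁l , al = dominator R ci≢h (ℕ.n≤1+n _) bi<ai
        in ℕ.1+n≢n (trans (sym al) (trans (cong (a h) (trans (only l i◁l) (sym (only k i◁k)))) ak))

    u-count : ∀ {i} → Vec.lookup c i ≡ u → suc (b h (σ i)) < a h i ⊎ (b h (σ i) < a h i × b r (σ i) < a r i)
    u-count ci with labelled ci
    ... | two {j} {k} j≢k i◁j i◁k with Vec.lookup c j in cj | Vec.lookup c k in ck
    ... | h | h = inj₁ (doubly-dominated⇒ R j≢k i◁j i◁k cj ck)
    ... | r | _ = inj₂ (h<-of-◁ ci i◁j , dominated⇒ R i◁j cj)
    ... | _ | r = inj₂ (h<-of-◁ ci i◁j , dominated⇒ R i◁k ck)
    ... | u | _ = contradiction i◁j (same-letter⇒¬◁ R ci cj)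
    ... | _ | u = contradiction i◁k (same-letter⇒¬◁ R ci ck)

  -- The counts concern h and r only, so dominating u's need separate treatment. Every r and every u
  -- has an h above it, which keeps both from dominating an h. A u above an r would put two h's, or
  -- another r, above that r.
  admissible⇒labelling : Admissible c σ → Labelling c σ
  admissible⇒labelling adm = label-of
    where
    open Admissible adm

    differ : ∀ {i} → Vec.lookup c i ≡ x → x ≢ y → Vec.lookup c i ≢ y
    differ ci x≢y ci′ = x≢y (trans (sym ci) ci′)

    u-dominators : ∀ {i} → Vec.lookup c i ≡ u →
      ∃₂ λ j k → j ≢ k × Vec.lookup c j ≡ h × σ ⊢ i ◁ j × σ ⊢ i ◁ k × (Vec.lookup c k ≡ h ⊎ Vec.lookup c k ≡ r)
    u-dominators ci with u-count ci
    ... | inj₁ hh =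
      let j , cj , i◁j , aj = dominator R {x = h} (differ ci λ ()) ℕ.≤-refl (ℕ.<⇒≤ hh)
          k , ck , i◁k , ak = dominator R {x = h} (differ ci λ ()) (ℕ.n≤1+n _) hh
      in j , k , (λ j≡k → ℕ.1+n≢n (trans (sym ak) (trans (cong (a h) (sym j≡k)) aj))) ,
         cj , i◁j , i◁k , inj₁ ck
    ... | inj₂ (h< , r<) =
      let j , cj , i◁j , _ = dominator R {x = h} (differ ci λ ()) ℕ.≤-refl h<
          k , ck , i◁k , _ = dominator R {x = r} (differ ci λ ()) ℕ.≤-refl r<
      in j , k , (λ j≡k → differ {y = r} cj (λ ()) (trans (cong (Vec.lookup c) j≡k) ck)) ,
         cj , i◁j , i◁k , inj₂ ck

    r-dominator : ∀ {i} → Vec.lookup c i ≡ r → ∃ λ j → Vec.lookup c j ≡ h × σ ⊢ i ◁ j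
    r-dominator ci =
      let j , cj , i◁j , _ = dominator R {x = h} (differ ci λ ()) ℕ.≤-refl (ℕ.≤-reflexive (sym (r-count ci)))
      in j , cj , i◁j

    label-of : ∀ i → Label σ i (Vec.lookup c i)
    label-of i with Vec.lookup c i in ci
    ... | u = let _ , _ , j≢k , _ , i◁j , i◁k , _ = u-dominators ci in two j≢k i◁j i◁k
    ... | h = none not-dominated
      where
      not-dominated : ∀ j → ¬ σ ⊢ i ◁ j
      not-dominated j i◁j with Vec.lookup c j in cj
      ... | h = same-letter⇒¬◁ R ci cj i◁j
      ... | r = let _ , ck , j◁k = r-dominator cj in
                same-letter⇒¬◁ R ci ck (◁-trans {σ = σ} i◁j j◁k)
      ... | u = let _ , _ , _ , ck , j◁k , _ = u-dominators cj in
                same-letter⇒¬◁ R ci ck (◁-trans {σ = σ} i◁j j◁k)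
    ... | r = let j , cj , i◁j = r-dominator ci in one i◁j (only cj i◁j)
      where
      not-two-h : ∀ {k l} → k ≢ l → σ ⊢ i ◁ k → σ ⊢ i ◁ l → Vec.lookup c k ≡ h → ¬ Vec.lookup c l ≡ h
      not-two-h k≢l i◁k i◁l ck cl =
        ℕ.<-irrefl (sym (r-count ci)) (doubly-dominated⇒ R k≢l i◁k i◁l ck cl)
      only : ∀ {j} → Vec.lookup c j ≡ h → σ ⊢ i ◁ j → ∀ k → σ ⊢ i ◁ k → k ≡ j
      only {j} cj i◁j k i◁k with Vec.lookup c k in ck
      ... | h = decidable-stable (k Fin.≟ j) λ k≢j → not-two-h k≢j i◁k i◁j ck cj
      ... | r = contradiction i◁k (same-letter⇒¬◁ R ci ck)
      ... | u with u-dominators ck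
      ...   | l , l′ , l≢l′ , cl , k◁l , k◁l′ , inj₁ cl′ =
                contradiction cl′ (not-two-h l≢l′ (◁-trans {σ = σ} i◁k k◁l) (◁-trans {σ = σ} i◁k k◁l′) cl)
      ...   | l , l′ , _ , _ , _ , k◁l′ , inj₂ cl′ =
                contradiction (◁-trans {σ = σ} i◁k k◁l′) (same-letter⇒¬◁ R ci cl′)

-- Forkless involutions reverse their label classes

module _ {σ : Fin m → Fin m} (inv : Involutive _≡_ σ) where

  private
    ◁-image : ∀ {i j} → σ ⊢ i ◁ j → σ ⊢ σ i ◁ σ j
    ◁-image {i} {j} (i<j , σi<σj) = σi<σj , subst₂ Fin._<_ (sym (inv i)) (sym (inv j)) i<j

    ◁-preimage : ∀ {i j} → σ ⊢ σ i ◁ j → σ ⊢ i ◁ σ j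
    ◁-preimage {i} {j} σi◁j = subst (λ k → σ ⊢ k ◁ σ j) (inv i) (◁-image σi◁j)

  -- Transposing the diagram preserves the relation north-east, so σ maps the dominators of i onto
  -- those of `σ i`.
  Label-image : ∀ {i} → Label σ i x → Label σ (σ i) x
  Label-image (none p)       = none λ j σi◁j → p (σ j) (◁-preimage σi◁j)
  Label-image (one i◁j only) = one (◁-image i◁j) λ k σi◁k → trans (sym (inv k)) (cong σ (only (σ k) (◁-preimage σi◁k)))
  Label-image (two j≢k p q)  = two (j≢k ∘ involutive⇒injective inv) (◁-image p) (◁-image q)

  module _ (forkless : Forkless σ) {c : Vec Letter m} (ℓ : Labelling c σ) where

    private
      b a : Letter → Fin m → ℕ
      b x i = count x (before c i)
      a x i = count x (after c i)

    -- For r, the dominator of j would also dominate i and so coincide with j. For u, the two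
    -- dominators of j complete a fork; only this case uses avoidance.
    same-label⇒¬◁ : ∀ {i j} → Label σ i x → Label σ j x → ¬ σ ⊢ i ◁ j
    same-label⇒¬◁ (none p) _ i◁j = p _ i◁j
    same-label⇒¬◁ (one i◁k only) (one j◁l _) i◁j =
      ◁-irrefl {σ = σ} (subst₂ (σ ⊢_◁_) (only _ i◁j) (only _ (◁-trans {σ = σ} i◁j j◁l)) j◁l)
    same-label⇒¬◁ _ (two k≢l j◁k j◁l) i◁j = forkless i◁j k≢l j◁k j◁l

    antitone : ∀ {i j} → Vec.lookup c i ≡ x → Vec.lookup c j ≡ x → i Fin.< j → σ j Fin.< σ i
    antitone {i = i} {j} ci cj i<j with Fin.<-cmp (σ i) (σ j)
    ... | tri< σi<σj _ _ = contradiction (i<j , σi<σj) (same-label⇒¬◁ (subst (Label σ i) ci (ℓ i)) (subst (Label σ j) cj (ℓ j)))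
    ... | tri≈ _ σi≡σj _ = contradiction (cong toℕ (involutive⇒injective inv σi≡σj)) (ℕ.<⇒≢ i<j)
    ... | tri> _ _ σj<σi = σj<σi

    image-letter : ∀ i → Vec.lookup c (σ i) ≡ Vec.lookup c i
    image-letter i = Label-unique (ℓ (σ i)) (Label-image (ℓ i))

    -- Induction along the class from the right: passing to the next x after i lowers k by one and
    -- strictly lowers the image. `before≤after` is the same from the left.
    after≤before : ∀ {i} → Vec.lookup c i ≡ x → ∀ k → a x i ≡ k → k ≤ b x (σ i)
    after≤before ci zero ai = z≤n
    after≤before {x = x} {i} ci (suc k) ai
      -- The next x after i is the one with one more x before it.
      with j , cj , bj ← find-position c x {suc (b x i)}
                           (subst (suc (b x i) <_) (sym (trans (count-at c ci) (cong (λ l → suc (b x i + l)) ai)))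
                             (s≤s (ℕ.≤-trans (s≤s (ℕ.m≤m+n _ k)) (ℕ.≤-reflexive (sym (+-suc (b x i) k)))))) =
      begin-strict
      k         ≤⟨ after≤before cj k aj ⟩
      b x (σ j) <⟨ before-< c (trans (image-letter j) cj) (antitone ci cj i<j) ⟩
      b x (σ i) ∎
      where
      open ℕ.≤-Reasoning
      i<j : i Fin.< j
      i<j = ℕ.≰⇒> λ j≤i → ℕ.<⇒≱ (ℕ.≤-reflexive (sym bj)) (before-≤ c x j≤i)
      aj : a x j ≡ k
      aj = ℕ.+-cancelˡ-≡ (suc (b x i)) _ _ (suc-injective totals)
        where
        totals : suc (suc (b x i) + a x j) ≡ suc (suc (b x i) + k)
        totals = trans (cong (λ l → suc (l + a x j)) (sym bj)) (trans (sym (count-at c cj))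
                   (trans (count-at c ci) (cong suc (trans (cong (b x i +_) ai) (+-suc _ k)))))

    before≤after : ∀ {i} → Vec.lookup c i ≡ x → ∀ k → b x i ≡ k → k ≤ a x (σ i)
    before≤after ci zero bi = z≤n
    before≤after {x = x} {i} ci (suc k) bi
      with j , cj , bj ← find-position c x {k} (ℕ.≤-trans (ℕ.≤-reflexive (sym bi))
                           (ℕ.≤-trans (ℕ.m≤m+n _ (a x i))
                             (ℕ.≤-trans (ℕ.n≤1+n _) (ℕ.≤-reflexive (sym (count-at c ci)))))) =
      begin-strict
      k         ≤⟨ before≤after cj k bj ⟩
      a x (σ j) <⟨ after-< c (trans (image-letter j) cj) (antitone cj ci j<i) ⟩
      a x (σ i) ∎
      where
      open ℕ.≤-Reasoning
      j<i : j Fin.< i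
      j<i = ℕ.≰⇒> λ i≤j → ℕ.<⇒≱ (ℕ.≤-reflexive (trans (cong suc bj) (sym bi))) (before-≤ c x i≤j)

    -- The second inequality is `before≤after` at `σ i`, transported along `σ (σ i) ≡ i`.
    forkless-involution⇒reversal : Reversal c σ
    forkless-involution⇒reversal = record
      { keeps = image-letter
      ; flips = λ ci → ℕ.≤-antisym (before≤after′ ci) (after≤before ci _ refl)
      }
      where
      before≤after′ : ∀ {i} → Vec.lookup c i ≡ x → b x (σ i) ≤ a x i
      before≤after′ {x = x} {i} ci = subst (λ j → b x (σ i) ≤ a x j) (inv i)
        (before≤after (trans (image-letter i) ci) _ refl)

-- Conditions on words

skeleton : List Letter → List Letter
skeleton = filter (λ x → ¬? (x ≟ u))

skeleton-++ : ∀ v {w} → skeleton (v ++ w) ≡ skeleton v ++ skeleton w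
skeleton-++ v = filter-++ _ v _

skeleton-reverse : ∀ v → skeleton (reverse v) ≡ reverse (skeleton v)
skeleton-reverse = filter-reverse _

length-skeleton-reverse : ∀ β → length (skeleton (reverse β)) ≡ length (skeleton β)
length-skeleton-reverse β = trans (cong length (skeleton-reverse β)) (length-reverse (skeleton β))

count-skeleton : ∀ {x} → x ≢ u → ∀ v → count x (skeleton v) ≡ count x v
count-skeleton x≢u []      = refl
count-skeleton {x} x≢u (y ∷ v) with y ≟ u
... | yes refl = trans (count-skeleton x≢u v) (sym (count-other (x≢u ∘ sym)))
... | no  _    = trans (count-∷ x y) (trans (cong (count x [ y ] +_) (count-skeleton x≢u v)) (sym (count-∷ x y)))

length-counts : ∀ {v} → All (_≢ u) v → length v ≡ count h v + count r v
length-counts []                = sym (cong₂ _+_ (count-nil h) (count-nil r))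
length-counts (_∷_ {h} {v} _ p) = trans (cong suc (length-counts p))
  (sym (cong₂ _+_ (count-here h) (count-other λ ())))
length-counts (_∷_ {r} {v} _ p) = trans (cong suc (length-counts p))
  (sym (trans (cong₂ _+_ (count-other λ ()) (count-here r)) (+-suc (count h v) (count r v))))
length-counts (_∷_ {u} u≢u _)   = contradiction refl u≢u

skeleton-length : ∀ v → length (skeleton v) ≡ count h v + count r v
skeleton-length v = trans (length-counts (all-filter _ v))
  (cong₂ _+_ (count-skeleton (λ ()) v) (count-skeleton (λ ()) v))

skeleton-split : ∀ v {α β} → x ≢ u → skeleton v ≡ α ++ x ∷ β →
                 ∃₂ λ α′ β′ → v ≡ α′ ++ x ∷ β′ × skeleton α′ ≡ α × skeleton β′ ≡ β
skeleton-split []      {[]}    x≢u ()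
skeleton-split []      {_ ∷ _} x≢u ()
skeleton-split (y ∷ v) {α} x≢u eq with y ≟ u in y≟u
skeleton-split (y ∷ v) {[]}    x≢u eq | no _ with refl , refl ← ∷-injective eq = [] , v , refl , refl , refl
skeleton-split (y ∷ v) {z ∷ α} x≢u eq | no _ with refl , eq′ ← ∷-injective eq
  with α′ , β′ , refl , refl , refl ← skeleton-split v {α} x≢u eq′ =
  y ∷ α′ , β′ , refl , keep , refl
  where
  keep : skeleton (y ∷ α′) ≡ y ∷ skeleton α′
  keep rewrite y≟u = refl
skeleton-split (y ∷ v) x≢u eq | yes refl
  with α′ , β′ , refl , refl , refl ← skeleton-split v x≢u eq = u ∷ α′ , β′ , refl , refl , refl

-- The two x's exchanged by a reversal: the one with as many x's before it as
-- the other has after it.  P relates what precedes the former and follows the latter.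
Mirrored : Letter → (List Letter → List Letter → Set) → List Letter → Set
Mirrored x P v = ∀ {α β α′ β′} → v ≡ α ++ x ∷ β → v ≡ α′ ++ x ∷ β′ →
                 count x α′ ≡ count x β → P α′ β

-- A word in h and r is encoded by its numbers of h's and r's together with the number of h's before
-- each r.
rs-agree⇒≡ : ∀ {v w} → All (_≢ u) v → All (_≢ u) w → count h v ≡ count h w → count r v ≡ count r w →
             (∀ {α β α′ β′} → v ≡ α ++ r ∷ β → w ≡ α′ ++ r ∷ β′ →
              count r α ≡ count r α′ → count h α ≡ count h α′) →
             v ≡ w
rs-agree⇒≡ [] [] _ _ _ = refl
rs-agree⇒≡ (_∷_ {u} u≢u _) _ _ _ _ = contradiction refl u≢u
rs-agree⇒≡ _ (_∷_ {u} u≢u _) _ _ _ = contradiction refl u≢u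
rs-agree⇒≡ [] (_∷_ {h} _ _) ch _ _ = contradiction (trans (sym (count-nil h)) (trans ch (count-here h))) λ ()
rs-agree⇒≡ [] (_∷_ {r} _ _) _ cr _ = contradiction (trans (sym (count-nil r)) (trans cr (count-here r))) λ ()
rs-agree⇒≡ (_∷_ {h} _ _) [] ch _ _ = contradiction (trans (sym (count-nil h)) (trans (sym ch) (count-here h))) λ ()
rs-agree⇒≡ (_∷_ {r} _ _) [] _ cr _ = contradiction (trans (sym (count-nil r)) (trans (sym cr) (count-here r))) λ ()
rs-agree⇒≡ (_∷_ {h} {v} _ pv) (_∷_ {h} {w} _ pw) ch cr agree = cong (h ∷_) (rs-agree⇒≡ pv pw
  (suc-injective (trans (sym (count-here h)) (trans ch (count-here h))))
  (trans (sym (count-other λ ())) (trans cr (count-other λ ())))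
  λ { {α} {_} {α′} refl refl eq → suc-injective (trans (sym (count-here h)) (trans
        (agree {h ∷ α} {_} {h ∷ α′} refl refl (trans (count-other λ ()) (trans eq (sym (count-other λ ())))))
        (count-here h))) })
rs-agree⇒≡ (_∷_ {r} {v} _ pv) (_∷_ {r} {w} _ pw) ch cr agree = cong (r ∷_) (rs-agree⇒≡ pv pw
  (trans (sym (count-other λ ())) (trans ch (count-other λ ())))
  (suc-injective (trans (sym (count-here r)) (trans cr (count-here r))))
  λ { {α} {_} {α′} refl refl eq → trans (sym (count-other λ ())) (trans
        (agree {r ∷ α} {_} {r ∷ α′} refl refl (trans (count-here r) (trans (cong suc eq) (sym (count-here r)))))
        (count-other λ ())) })
rs-agree⇒≡ (_∷_ {h} {v} _ pv) (_∷_ {r} {w} _ pw) ch cr agree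
  -- The first r of `h ∷ v` corresponds to the leading r of the other word, yet an h precedes it.
  with α , β , refl , eq ← find-split r v {0}
                           (subst (0 <_) (trans (sym (trans cr (count-here r))) (count-other λ ())) z<s) =
  contradiction (trans (sym (count-here h)) (trans (agree {h ∷ α} {_} {[]} refl refl
    (trans (count-other λ ()) (trans eq (sym (count-nil r))))) (count-nil h))) λ ()
rs-agree⇒≡ (_∷_ {r} {v} _ pv) (_∷_ {h} {w} _ pw) ch cr agree
  with α , β , refl , eq ← find-split r w {0}
                           (subst (0 <_) (trans (trans (sym (count-here r)) cr) (count-other λ ())) z<s) =
  contradiction (trans (sym (count-here h)) (sym (trans (sym (count-nil h)) (agree {[]} {_} {h ∷ α} refl refl
    (trans (count-nil r) (sym (trans (count-other λ ()) eq))))))) λ ()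

-- The first two are the clauses of `Admissible` with the final h removed, which lowers each number
-- of h's after a letter by one. The third is the form of the second that controls heights.
r-balanced u-balanced u-separated : List Letter → Set
r-balanced  = Mirrored r λ α β → count h α ≡ count h β
u-balanced  = Mirrored u λ α β →
  count h α < count h β ⊎ (count h α ≤ count h β × count r α < count r β)
u-separated = Mirrored u λ α β → length (skeleton α) < length (skeleton β)

-- Balance says that the k-th r of `v` and the k-th r of its reversal have equally many h's before
-- them.
r-balanced⇒palindrome : ∀ v → r-balanced v → skeleton v ≡ skeleton (reverse v)
r-balanced⇒palindrome v bal = rs-agree⇒≡ (all-filter _ v) (all-filter _ (reverse v))
  (counts (λ ())) (counts (λ ())) agree
  where
  counts : ∀ {x} → x ≢ u → count x (skeleton v) ≡ count x (skeleton (reverse v))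
  counts {x} x≢u = trans (count-skeleton x≢u v) (trans (sym (count-reverse x v)) (sym (count-skeleton x≢u (reverse v))))
  agree : ∀ {α β α′ β′} → skeleton v ≡ α ++ r ∷ β → skeleton (reverse v) ≡ α′ ++ r ∷ β′ →
          count r α ≡ count r α′ → count h α ≡ count h α′
  agree eq eq′ cr with skeleton-split v (λ ()) eq | skeleton-split (reverse v) (λ ()) eq′
  ... | α , _ , v≡ , refl , _ | α′ , β′ , v′≡ , refl , _ = begin
    count h (skeleton α)   ≡⟨ count-skeleton (λ ()) α ⟩
    count h α              ≡⟨ bal (trans (sym (reverse-involutive v))
                                     (trans (cong reverse v′≡) (reverse-split α′ r β′)))
                                v≡
                                (trans (sym (count-skeleton (λ ()) α))
                                  (trans cr (trans (count-skeleton (λ ()) α′) (sym (count-reverse r α′))))) ⟩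
    count h (reverse α′)   ≡⟨ count-reverse h α′ ⟩
    count h α′             ≡⟨ count-skeleton (λ ()) α′ ⟨
    count h (skeleton α′)  ∎
    where open ≡-Reasoning

module _ {v : List Letter} (palindrome : skeleton v ≡ skeleton (reverse v)) where

  private
    -- By the palindrome, the part before one letter and the reversed part after the other are
    -- prefixes of one skeleton. Hence one extends the other, and their lengths decide how all
    -- counts compare.
    skeletons : ∀ {α β α′ β′} → v ≡ α ++ x ∷ β → v ≡ α′ ++ y ∷ β′ →
                skeleton α′ ++ skeleton (y ∷ β′) ≡ skeleton (reverse β) ++ skeleton (x ∷ reverse α)
    skeletons {x} {y} {α} {β} {α′} {β′} eq eq′ = begin
      skeleton α′ ++ skeleton (y ∷ β′)                  ≡⟨ skeleton-++ α′ ⟨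
      skeleton (α′ ++ y ∷ β′)                           ≡⟨ cong skeleton eq′ ⟨
      skeleton v                                        ≡⟨ palindrome ⟩
      skeleton (reverse v)                              ≡⟨ cong (skeleton ∘ reverse) eq ⟩
      skeleton (reverse (α ++ x ∷ β))                   ≡⟨ cong skeleton (reverse-split α x β) ⟩
      skeleton (reverse β ++ x ∷ reverse α)             ≡⟨ skeleton-++ (reverse β) ⟩
      skeleton (reverse β) ++ skeleton (x ∷ reverse α)  ∎
      where open ≡-Reasoning

    count-skeleton-reverse : ∀ {x} → x ≢ u → ∀ β → count x (skeleton (reverse β)) ≡ count x β
    count-skeleton-reverse {x} x≢u β = trans (count-skeleton x≢u (reverse β)) (count-reverse x β)

    prefix-count : ∀ x {α es} {β} → β ≡ α ++ es → count x α ≤ count x β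
    prefix-count x {α} refl = ℕ.≤-trans (ℕ.m≤m+n _ _) (ℕ.≤-reflexive (sym (count-++ x α)))

    shorter : ∀ {x} → x ≢ u → ∀ {α β α′ β′} → v ≡ α ++ u ∷ β → v ≡ α′ ++ u ∷ β′ →
              length (skeleton α′) ≤ length (skeleton β) → count x α′ ≤ count x β
    shorter {x} x≢u {β = β} {α′} eq eq′ len
      with es , eq″ ← ++-longer (skeleton α′) (skeleton (reverse β)) (skeletons eq eq′)
                        (ℕ.≤-trans len (ℕ.≤-reflexive (sym (length-skeleton-reverse β)))) =
      subst₂ _≤_ (count-skeleton x≢u α′) (count-skeleton-reverse x≢u β) (prefix-count x eq″)

    longer : ∀ {x} → x ≢ u → ∀ {α β α′ β′} → v ≡ α ++ u ∷ β → v ≡ α′ ++ u ∷ β′ →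
             length (skeleton β) ≤ length (skeleton α′) → count x β ≤ count x α′
    longer {x} x≢u {β = β} {α′} eq eq′ len
      with es , eq″ ← ++-longer (skeleton (reverse β)) (skeleton α′) (sym (skeletons eq eq′))
                        (ℕ.≤-trans (ℕ.≤-reflexive (length-skeleton-reverse β)) len) =
      subst₂ _≤_ (count-skeleton-reverse x≢u β) (count-skeleton x≢u α′) (prefix-count x eq″)

  palindrome⇒r-balanced : r-balanced v
  palindrome⇒r-balanced {β = β} {α′} eq eq′ cr = begin
    count h α′                       ≡⟨ count-skeleton (λ ()) α′ ⟨
    count h (skeleton α′)            ≡⟨ cong (count h) (proj₁ (split-unique r
                                          (skeleton α′) (skeleton (reverse β)) (skeletons eq eq′)
                                          (trans (count-skeleton (λ ()) α′)
                                            (trans cr (sym (count-skeleton-reverse (λ ()) β)))))) ⟩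
    count h (skeleton (reverse β))   ≡⟨ count-skeleton-reverse (λ ()) β ⟩
    count h β                        ∎
    where open ≡-Reasoning

  u-balanced⇒u-separated : u-balanced v → u-separated v
  u-balanced⇒u-separated bal eq eq′ cu = ℕ.≰⇒> λ β≤α′ → impossible β≤α′ (bal eq eq′ cu)
    where
    impossible : _ → _ → ⊥
    impossible β≤α′ (inj₁ h<)       = ℕ.<⇒≱ h< (longer (λ ()) eq eq′ β≤α′)
    impossible β≤α′ (inj₂ (_ , r<)) = ℕ.<⇒≱ r< (longer (λ ()) eq eq′ β≤α′)

  u-separated⇒u-balanced : u-separated v → u-balanced v
  u-separated⇒u-balanced sep {β = β} {α′} eq eq′ cu with sep eq eq′ cu
  ... | α′<β with ℕ.m≤n⇒m<n∨m≡n (shorter {h} (λ ()) eq eq′ (ℕ.<⇒≤ α′<β))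
  ... | inj₁ h< = inj₁ h<
  -- With equally many h's, the strict difference in length must come from the r's.
  ... | inj₂ h≡ = inj₂ (ℕ.≤-reflexive h≡ , ℕ.+-cancelˡ-< (count h β) _ _
        (subst₂ _<_ (trans (skeleton-length α′) (cong (_+ count r α′) h≡)) (skeleton-length β) α′<β))

-- Paths as merges of two words

-- No d-step is pending before the next h, the next peak or the end.
data Ready : List Letter → Set where
  []  : Ready []
  h∷_ : ∀ w → Ready (h ∷ w)
  r∷_ : ∀ w → Ready (r ∷ w)

-- w lists the d-steps as letters u.  Between consecutive h's and peaks the
-- d-steps come first, as a ud would be a peak; hence the condition in ‘up’.
data Merge : List Letter → List Letter → List Step → Set where
  done : Merge [] [] []
  down : Merge v w p → Merge v (u ∷ w) (d ∷ p)
  up   : Ready w → Merge v w p → Merge (u ∷ v) w (u ∷ p)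
  flat : Merge v w p → Merge (h ∷ v) (h ∷ w) (h ∷ p)
  peak : Merge v w p → Merge (r ∷ v) (r ∷ w) (u ∷ d ∷ p)

-- `Ready` keeps `up` and `down` from applying to the same words; the first letters separate the
-- other constructors. So a symmetric path is determined by its contraction.
Merge-unique : Merge v w p → Merge v w q → p ≡ q
Merge-unique done     done     = refl
Merge-unique (down m) (down n) = cong (d ∷_) (Merge-unique m n)
Merge-unique (up _ m) (up _ n) = cong (u ∷_) (Merge-unique m n)
Merge-unique (flat m) (flat n) = cong (h ∷_) (Merge-unique m n)
Merge-unique (peak m) (peak n) = cong (λ p → u ∷ d ∷ p) (Merge-unique m n)

Merge-skeleton : Merge v w p → skeleton v ≡ skeleton w
Merge-skeleton done     = refl
Merge-skeleton (down m) = Merge-skeleton m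
Merge-skeleton (up _ m) = Merge-skeleton m
Merge-skeleton (flat m) = cong (h ∷_) (Merge-skeleton m)
Merge-skeleton (peak m) = cong (r ∷_) (Merge-skeleton m)

merge : ∀ v w → skeleton v ≡ skeleton w → ∃ (Merge v w)
merge v       (u ∷ w) eq = _ , down (proj₂ (merge v w eq))
merge (u ∷ v) []      eq = _ , up [] (proj₂ (merge v [] eq))
merge (u ∷ v) (h ∷ w) eq = _ , up (h∷ w) (proj₂ (merge v (h ∷ w) eq))
merge (u ∷ v) (r ∷ w) eq = _ , up (r∷ w) (proj₂ (merge v (r ∷ w) eq))
merge []      []      eq = _ , done
merge (h ∷ v) (h ∷ w) eq = _ , flat (proj₂ (merge v w (∷-injectiveʳ eq)))
merge (r ∷ v) (r ∷ w) eq = _ , peak (proj₂ (merge v w (∷-injectiveʳ eq)))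
merge []      (h ∷ w) ()
merge []      (r ∷ w) ()
merge (h ∷ v) []      ()
merge (r ∷ v) []      ()
merge (h ∷ v) (r ∷ w) ()
merge (r ∷ v) (h ∷ w) ()

-- Like ‘contract’ with the roles of the unmatched u's and d's exchanged; the d's
-- become letters u.
contractᵈ : List Step → List Letter
contractᵈ []          = []
contractᵈ (h ∷ p)     = h ∷ contractᵈ p
contractᵈ (u ∷ d ∷ p) = r ∷ contractᵈ p
contractᵈ (u ∷ p)     = contractᵈ p
contractᵈ (d ∷ p)     = u ∷ contractᵈ p

-- After `up` no `down` can follow, by `Ready`; so the u-step does not begin a peak and `contract`
-- keeps it.
Merge-contract : Merge v w p → contract p ≡ v
Merge-contract done                      = refl
Merge-contract (down m)                  = Merge-contract m
Merge-contract (up _ done)               = refl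
Merge-contract (up _ m@(up _ _))         = cong (u ∷_) (Merge-contract m)
Merge-contract (up _ m@(flat _))         = cong (u ∷_) (Merge-contract m)
Merge-contract (up _ m@(peak _))         = cong (u ∷_) (Merge-contract m)
Merge-contract (flat m)                  = cong (h ∷_) (Merge-contract m)
Merge-contract (peak m)                  = cong (r ∷_) (Merge-contract m)

Merge-contractᵈ : Merge v w p → contractᵈ p ≡ w
Merge-contractᵈ done                     = refl
Merge-contractᵈ (down m)                 = cong (u ∷_) (Merge-contractᵈ m)
Merge-contractᵈ (up _ done)              = refl
Merge-contractᵈ (up _ m@(up _ _))        = Merge-contractᵈ m
Merge-contractᵈ (up _ m@(flat _))        = Merge-contractᵈ m
Merge-contractᵈ (up _ m@(peak _))        = Merge-contractᵈ m
Merge-contractᵈ (flat m)                 = cong (h ∷_) (Merge-contractᵈ m)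
Merge-contractᵈ (peak m)                 = cong (r ∷_) (Merge-contractᵈ m)

contractᵈ-ready : ∀ p → Ready (contractᵈ (u ∷ p))
contractᵈ-ready []      = []
contractᵈ-ready (h ∷ p) = h∷ _
contractᵈ-ready (d ∷ p) = r∷ _
contractᵈ-ready (u ∷ p) = contractᵈ-ready p

contract-Merge : ∀ p → Merge (contract p) (contractᵈ p) p
contract-Merge []          = done
contract-Merge (h ∷ p)     = flat (contract-Merge p)
contract-Merge (u ∷ d ∷ p) = peak (contract-Merge p)
contract-Merge (u ∷ [])    = up [] done
contract-Merge (u ∷ h ∷ p) = up (h∷ _) (contract-Merge (h ∷ p))
contract-Merge (u ∷ u ∷ p) = up (contractᵈ-ready p) (contract-Merge (u ∷ p))
contract-Merge (d ∷ p)     = down (contract-Merge p)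

-- Reflecting paths

bar : Step → Step
bar h = h
bar u = d
bar d = u

reflect : List Step → List Step
reflect p = reverse (map bar p)

reflect-∷ : ∀ s p → reflect (s ∷ p) ≡ reflect p ++ [ bar s ]
reflect-∷ s p = unfold-reverse (bar s) (map bar p)

reflect-∷∷ : ∀ s t p → reflect (s ∷ t ∷ p) ≡ reflect p ++ bar t ∷ bar s ∷ []
reflect-∷∷ s t p = trans (reflect-∷ s (t ∷ p)) (trans (cong (_++ [ bar s ]) (reflect-∷ t p)) (++-assoc (reflect p) _ _))

reflect-involutive : ∀ p → reflect (reflect p) ≡ p
reflect-involutive p = begin
  reverse (map bar (reverse (map bar p))) ≡⟨ cong reverse (reverse-map bar (map bar p)) ⟩
  reverse (reverse (map bar (map bar p))) ≡⟨ reverse-involutive _ ⟩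
  map bar (map bar p)                     ≡⟨ map-involutive (λ { h → refl ; u → refl ; d → refl }) p ⟩
  p                                       ∎
  where open ≡-Reasoning

-- Cutting in front of a d could split a peak; `contract-++-d` cuts behind it instead.
contract-++ : ∀ p {s q} → s ≢ d → contract (p ++ s ∷ q) ≡ contract p ++ contract (s ∷ q)
contract-++ []              s≢d = refl
contract-++ (h ∷ p)         s≢d = cong (h ∷_) (contract-++ p s≢d)
contract-++ (u ∷ d ∷ p)     s≢d = cong (r ∷_) (contract-++ p s≢d)
contract-++ (u ∷ []) {h}    s≢d = refl
contract-++ (u ∷ []) {u}    s≢d = refl
contract-++ (u ∷ []) {d}    s≢d = contradiction refl s≢d
contract-++ (u ∷ h ∷ p)     s≢d = cong (u ∷_) (contract-++ (h ∷ p) s≢d)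
contract-++ (u ∷ u ∷ p)     s≢d = cong (u ∷_) (contract-++ (u ∷ p) s≢d)
contract-++ (d ∷ p)         s≢d = contract-++ p s≢d

contract-++-d : ∀ p {q} → contract (p ++ d ∷ q) ≡ contract (p ++ [ d ]) ++ contract q
contract-++-d []              = refl
contract-++-d (h ∷ p)         = cong (h ∷_) (contract-++-d p)
contract-++-d (u ∷ d ∷ p)     = cong (r ∷_) (contract-++-d p)
contract-++-d (u ∷ [])        = refl
contract-++-d (u ∷ h ∷ p)     = cong (u ∷_) (contract-++-d (h ∷ p))
contract-++-d (u ∷ u ∷ p)     = cong (u ∷_) (contract-++-d (u ∷ p))
contract-++-d (d ∷ p)         = contract-++-d p

-- Reflection preserves peaks and h's and exchanges the remaining u's and d's.
contract-reflect : ∀ p → contract (reflect p) ≡ reverse (contractᵈ p)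
contract-reflect [] = refl
contract-reflect (h ∷ p) = begin
  contract (reflect (h ∷ p))        ≡⟨ cong contract (reflect-∷ h p) ⟩
  contract (reflect p ++ [ h ])     ≡⟨ contract-++ (reflect p) (λ ()) ⟩
  contract (reflect p) ++ [ h ]     ≡⟨ cong (_++ [ h ]) (contract-reflect p) ⟩
  reverse (contractᵈ p) ++ [ h ]    ≡⟨ unfold-reverse h (contractᵈ p) ⟨
  reverse (h ∷ contractᵈ p)         ∎
  where open ≡-Reasoning
contract-reflect (d ∷ p) = begin
  contract (reflect (d ∷ p))        ≡⟨ cong contract (reflect-∷ d p) ⟩
  contract (reflect p ++ [ u ])     ≡⟨ contract-++ (reflect p) (λ ()) ⟩
  contract (reflect p) ++ [ u ]     ≡⟨ cong (_++ [ u ]) (contract-reflect p) ⟩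
  reverse (contractᵈ p) ++ [ u ]    ≡⟨ unfold-reverse u (contractᵈ p) ⟨
  reverse (u ∷ contractᵈ p)         ∎
  where open ≡-Reasoning
contract-reflect (u ∷ d ∷ p) = begin
  contract (reflect (u ∷ d ∷ p))     ≡⟨ cong contract (reflect-∷∷ u d p) ⟩
  contract (reflect p ++ u ∷ d ∷ []) ≡⟨ contract-++ (reflect p) (λ ()) ⟩
  contract (reflect p) ++ [ r ]      ≡⟨ cong (_++ [ r ]) (contract-reflect p) ⟩
  reverse (contractᵈ p) ++ [ r ]     ≡⟨ unfold-reverse r (contractᵈ p) ⟨
  reverse (r ∷ contractᵈ p)          ∎
  where open ≡-Reasoning
contract-reflect (u ∷ []) = refl
contract-reflect (u ∷ h ∷ p) = begin
  contract (reflect (u ∷ h ∷ p))     ≡⟨ cong contract (reflect-∷∷ u h p) ⟩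
  contract (reflect p ++ h ∷ d ∷ []) ≡⟨ contract-++ (reflect p) (λ ()) ⟩
  contract (reflect p) ++ [ h ]      ≡⟨ contract-++ (reflect p) (λ ()) ⟨
  contract (reflect p ++ [ h ])      ≡⟨ cong contract (reflect-∷ h p) ⟨
  contract (reflect (h ∷ p))         ≡⟨ contract-reflect (h ∷ p) ⟩
  reverse (contractᵈ (h ∷ p))        ∎
  where open ≡-Reasoning
contract-reflect (u ∷ u ∷ p) = begin
  contract (reflect (u ∷ u ∷ p))     ≡⟨ cong contract (reflect-∷∷ u u p) ⟩
  -- The last d follows a d, so it closes no peak and is deleted.
  contract (reflect p ++ d ∷ d ∷ []) ≡⟨ contract-++-d (reflect p) ⟩
  contract (reflect p ++ [ d ]) ++ [] ≡⟨ ++-identityʳ _ ⟩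
  contract (reflect p ++ [ d ])      ≡⟨ cong contract (reflect-∷ u p) ⟨
  contract (reflect (u ∷ p))         ≡⟨ contract-reflect (u ∷ p) ⟩
  reverse (contractᵈ (u ∷ p))        ∎
  where open ≡-Reasoning

contractᵈ-reflect : ∀ p → contractᵈ (reflect p) ≡ reverse (contract p)
contractᵈ-reflect p = trans (sym (reverse-involutive _))
  (cong reverse (trans (sym (contract-reflect (reflect p))) (cong contract (reflect-involutive p))))

reflect-invariant⇒Merge : reflect p ≡ p → Merge (contract p) (reverse (contract p)) p
reflect-invariant⇒Merge {p} inv = subst (λ w → Merge (contract p) w p)
  (trans (cong contractᵈ (sym inv)) (contractᵈ-reflect p)) (contract-Merge p)

-- The reflected path merges the same two words, so uniqueness applies.
Merge⇒reflect-invariant : Merge v (reverse v) p → reflect p ≡ p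
Merge⇒reflect-invariant {v} {p} m = Merge-unique
  (subst₂ (λ v w → Merge v w (reflect p))
    (trans (contract-reflect p) (trans (cong reverse (Merge-contractᵈ m)) (reverse-involutive v)))
    (trans (contractᵈ-reflect p) (cong reverse (Merge-contract m)))
    (contract-Merge (reflect p)))
  m

-- Heights

Above : ℕ → List Step → Set
Above k       []      = ⊤
Above k       (h ∷ p) = Above k p
Above k       (u ∷ p) = Above (suc k) p
Above zero    (d ∷ p) = ⊥
Above (suc k) (d ∷ p) = Above k p

-- In the merge of v and w started at height k, the u-step that makes room for
-- a given d-step comes before it.
Climb : ℕ → List Letter → List Letter → Set
Climb k v w = ∀ {α β} → w ≡ α ++ u ∷ β → count u α < k ⊎
  ∃₂ λ α′ β′ → v ≡ α′ ++ u ∷ β′ × k + count u α′ ≡ count u α × length (skeleton α′) < length (skeleton α)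

length-skeleton-∷ : x ≢ u → ∀ α → length (skeleton (x ∷ α)) ≡ suc (length (skeleton α))
length-skeleton-∷ x≢u α = cong length (filter-accept (λ y → ¬? (y ≟ u)) {xs = α} x≢u)

Climb-∷⁺ : ∀ {k} → x ≢ u → Climb k v w → Climb k (x ∷ v) (x ∷ w)
Climb-∷⁺ x≢u climb {[]} eq = contradiction (∷-injectiveˡ eq) x≢u
Climb-∷⁺ {x = x} x≢u climb {_ ∷ α} eq with refl , eq′ ← ∷-injective eq with climb eq′
... | inj₁ α<k = inj₁ (subst (_< _) (sym (count-other x≢u)) α<k)
... | inj₂ (α′ , β′ , refl , c , l) = inj₂ (x ∷ α′ , β′ , refl ,
        trans (cong (_ +_) (count-other x≢u)) (trans c (sym (count-other x≢u))) ,
        subst₂ _<_ (sym (length-skeleton-∷ x≢u α′)) (sym (length-skeleton-∷ x≢u α)) (s<s l))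

Climb-∷⁻ : ∀ {k} → x ≢ u → Climb k (x ∷ v) (x ∷ w) → Climb k v w
Climb-∷⁻ {x = x} x≢u climb {α} eq with climb {x ∷ α} (cong (x ∷_) eq)
... | inj₁ α<k = inj₁ (subst (_< _) (count-other x≢u) α<k)
... | inj₂ ([] , _ , eq′ , _) = contradiction (∷-injectiveˡ eq′) x≢u
... | inj₂ (_ ∷ α′ , β′ , eq′ , c , l) with refl , eq″ ← ∷-injective eq′ = inj₂ (α′ , β′ , eq″ ,
        trans (cong (_ +_) (sym (count-other x≢u))) (trans c (count-other x≢u)) ,
        ℕ.s<s⁻¹ (subst₂ _<_ (length-skeleton-∷ x≢u α′) (length-skeleton-∷ x≢u α) l))

Above⇒Climb : ∀ {k} → Merge v w p → Above k p → Climb k v w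
Above⇒Climb done _ {[]} ()
Above⇒Climb done _ {_ ∷ _} ()
Above⇒Climb (flat m) above = Climb-∷⁺ (λ ()) (Above⇒Climb m above)
Above⇒Climb (peak m) above = Climb-∷⁺ (λ ()) (Above⇒Climb m above)
Above⇒Climb {k = suc k} (down m) above {[]} eq = inj₁ (subst (_< suc k) (sym (count-nil u)) z<s)
Above⇒Climb {k = suc k} (down m) above {_ ∷ α} eq with refl , eq′ ← ∷-injective eq with Above⇒Climb m above eq′
... | inj₁ α<k = inj₁ (subst (_< suc k) (sym (count-here u)) (s<s α<k))
... | inj₂ (α′ , β′ , eq″ , c , l) = inj₂ (α′ , β′ , eq″ , trans (cong suc c) (sym (count-here u)) , l)
Above⇒Climb {k = k} (up {v = v} ready m) above {α} eq with Above⇒Climb m above eq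
... | inj₂ (α′ , β′ , refl , c , l) = inj₂ (u ∷ α′ , β′ , refl ,
        trans (cong (k +_) (count-here u)) (trans (+-suc k _) c) , l)
... | inj₁ (s≤s α≤k) with ℕ.m≤n⇒m<n∨m≡n α≤k
...   | inj₁ α<k = inj₁ α<k
-- This d is the one that the present u-step pays for, so nothing precedes the u. By `Ready`, an h
-- or r stands before the d, which gives the strict inequality.
...   | inj₂ α≡k = inj₂ ([] , v , refl ,
          trans (cong (k +_) (count-nil u)) (trans (ℕ.+-identityʳ k) (sym α≡k)) , nonempty ready α eq)
  where
  nonempty : Ready w → ∀ α {β} → w ≡ α ++ u ∷ β → 0 < length (skeleton α)
  nonempty []     []      ()
  nonempty []     (_ ∷ _) ()
  nonempty (h∷ w) []      ()
  nonempty (r∷ w) []      ()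
  nonempty (h∷ w) (x ∷ α) eq with refl ← ∷-injectiveˡ eq = z<s
  nonempty (r∷ w) (x ∷ α) eq with refl ← ∷-injectiveˡ eq = z<s

Climb⇒Above : ∀ {k} → Merge v w p → Climb k v w → Above k p
Climb⇒Above done _ = tt
Climb⇒Above (flat m) climb = Climb⇒Above m (Climb-∷⁻ (λ ()) climb)
Climb⇒Above (peak m) climb = Climb⇒Above m (Climb-∷⁻ (λ ()) climb)
Climb⇒Above {k = zero} (down m) climb with climb {[]} refl
... | inj₁ ()
... | inj₂ (_ , _ , _ , _ , ())
Climb⇒Above {k = suc k} (down {v} {w} m) climb = Climb⇒Above m climb′
  where
  climb′ : Climb k v w
  climb′ {α} refl with climb {u ∷ α} refl
  ... | inj₁ α<k = inj₁ (ℕ.s<s⁻¹ (subst (_< suc k) (count-here u) α<k))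
  ... | inj₂ (α′ , β′ , eq , c , l) = inj₂ (α′ , β′ , eq , suc-injective (trans c (count-here u)) , l)
Climb⇒Above {k = k} (up {w} {v} ready m) climb = Climb⇒Above m climb′
  where
  climb′ : Climb (suc k) v w
  climb′ eq with climb eq
  ... | inj₁ α<k = inj₁ (ℕ.m<n⇒m<1+n α<k)
  ... | inj₂ ([] , _ , _ , c , _) = inj₁ (s≤s (ℕ.≤-reflexive (trans (sym c) (trans (cong (k +_) (count-nil u)) (ℕ.+-identityʳ k)))))
  ... | inj₂ (_ ∷ α′ , β′ , eq′ , c , l) with refl , eq″ ← ∷-injective eq′ =
    inj₂ (α′ , β′ , eq″ , trans (sym (+-suc k _)) (trans (cong (k +_) (sym (count-here u))) c) , l)

-- The d's are the u's of `reverse v`. At height 0, the d with j d's before it needs the u with j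
-- u's before it; that d mirrors the u with j u's after it, and the two u's are paired in
-- `u-separated`.
u-separated⇒Climb : ∀ v → u-separated v → Climb 0 v (reverse v)
u-separated⇒Climb v sep {α} {β} eq = inj₂ (conclude (find-split u v enough))
  where
  v≡ : v ≡ reverse β ++ u ∷ reverse α
  v≡ = trans (sym (reverse-involutive v)) (trans (cong reverse eq) (reverse-split α u β))
  enough : count u α < count u v
  enough = begin-strict
    count u α                 <⟨ s≤s (ℕ.m≤m+n _ (count u β)) ⟩
    suc (count u α + count u β) ≡⟨ count-split u α ⟨
    count u (α ++ u ∷ β)      ≡⟨ cong (count u) eq ⟨
    count u (reverse v)       ≡⟨ count-reverse u v ⟩
    count u v                 ∎
    where open ℕ.≤-Reasoning
  conclude : (∃₂ λ α′ β′ → v ≡ α′ ++ u ∷ β′ × count u α′ ≡ count u α) → _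
  conclude (α′ , β′ , eq′ , c) = α′ , β′ , eq′ , c ,
    subst (_ <_) (length-skeleton-reverse α) (sep v≡ eq′ (trans c (sym (count-reverse u α))))

Climb⇒u-separated : ∀ v → Climb 0 v (reverse v) → u-separated v
Climb⇒u-separated v climb {α} {β} {α′} eq eq′ cu
  with climb (trans (cong reverse eq) (reverse-split α u β))
... | inj₂ (α″ , β″ , eq″ , c , l)
  with refl , _ ← split-unique u α″ α′ (trans (sym eq″) eq′) (trans c (trans (count-reverse u β) (sym cu))) =
  subst (_ <_) (length-skeleton-reverse β) l

-- Geometry of symmetric paths

▸-injective : ∀ a {s t} → a ▸ s ≡ a ▸ t → s ≡ t
▸-injective a {h} {h} eq = refl
▸-injective a {u} {u} eq = refl
▸-injective a {d} {d} eq = refl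
▸-injective (x , y) {h} {u} eq with () ← ℤ-group.∙-cancelˡ x _ _ (cong proj₁ eq)
▸-injective (x , y) {h} {d} eq with () ← ℤ-group.∙-cancelˡ x _ _ (cong proj₁ eq)
▸-injective (x , y) {u} {h} eq with () ← ℤ-group.∙-cancelˡ x _ _ (cong proj₁ eq)
▸-injective (x , y) {d} {h} eq with () ← ℤ-group.∙-cancelˡ x _ _ (cong proj₁ eq)
▸-injective (x , y) {u} {d} eq with () ← ℤ-group.∙-cancelˡ y _ _ (cong proj₂ eq)
▸-injective (x , y) {d} {u} eq with () ← ℤ-group.∙-cancelˡ y _ _ (cong proj₂ eq)

verticesFrom-head : ∀ a p → ∃ λ as → verticesFrom a p ≡ a ∷ as
verticesFrom-head a []      = _ , refl
verticesFrom-head a (s ∷ p) = _ , refl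

-- Symmetry is stated for vertices and reflection for steps; this brings equations between vertices
-- back to steps.
verticesFrom-injective : ∀ a p q → verticesFrom a p ≡ verticesFrom a q → p ≡ q
verticesFrom-injective a []      []      eq = refl
verticesFrom-injective a []      (t ∷ q) eq
  with () ← trans (∷-injectiveʳ eq) (proj₂ (verticesFrom-head (a ▸ t) q))
verticesFrom-injective a (s ∷ p) []      eq
  with () ← trans (sym (∷-injectiveʳ eq)) (proj₂ (verticesFrom-head (a ▸ s) p))
verticesFrom-injective a (s ∷ p) (t ∷ q) eq
  with refl ← ▸-injective a {s} {t} (∷-injectiveˡ (trans (sym (proj₂ (verticesFrom-head (a ▸ s) p)))
                (trans (∷-injectiveʳ eq) (proj₂ (verticesFrom-head (a ▸ t) q))))) =
  cong (s ∷_) (verticesFrom-injective (a ▸ s) p q (∷-injectiveʳ eq))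

verticesFrom-∷ʳ : ∀ a p s → verticesFrom a (p ∷ʳ s) ≡ verticesFrom a p ∷ʳ foldl _▸_ a (p ∷ʳ s)
verticesFrom-∷ʳ a []      s = refl
verticesFrom-∷ʳ a (t ∷ p) s = cong (a ∷_) (verticesFrom-∷ʳ (a ▸ t) p s)

mirror-involutive : ∀ n a → mirror n (mirror n a) ≡ a
mirror-involutive n (x , y) = cong (_, y) (lemma (pos (2 ℕ.* n)) x)
  where
  lemma : ∀ k x → k ℤ.- (k ℤ.- x) ≡ x
  lemma = solve-∀

-- Traversed backwards, the mirror image of the step `s` is `bar s`.
mirror-▸ : ∀ n a s → mirror n (a ▸ s) ▸ bar s ≡ mirror n a
mirror-▸ n (x , y) s = step s
  where
  k = pos (2 ℕ.* n)
  two-back : ∀ k x → (k ℤ.- (x ℤ.+ pos 2)) ℤ.+ pos 2 ≡ k ℤ.- x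
  two-back = solve-∀
  one-back : ∀ k x → (k ℤ.- (x ℤ.+ pos 1)) ℤ.+ pos 1 ≡ k ℤ.- x
  one-back = solve-∀
  up-down : ∀ y → (y ℤ.+ pos 1) ℤ.- pos 1 ≡ y
  up-down = solve-∀
  down-up : ∀ y → (y ℤ.- pos 1) ℤ.+ pos 1 ≡ y
  down-up = solve-∀
  step : ∀ s → mirror n ((x , y) ▸ s) ▸ bar s ≡ mirror n (x , y)
  step h = cong (_, y) (two-back k x)
  step u = cong₂ _,_ (one-back k x) (up-down y)
  step d = cong₂ _,_ (one-back k x) (down-up y)

foldl-reflect : ∀ n a p → foldl _▸_ (mirror n (foldl _▸_ a p)) (reflect p) ≡ mirror n a
foldl-reflect n a []      = refl
foldl-reflect n a (s ∷ p) = begin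
  foldl _▸_ e (reflect (s ∷ p))      ≡⟨ cong (foldl _▸_ e) (reflect-∷ s p) ⟩
  foldl _▸_ e (reflect p ∷ʳ bar s)   ≡⟨ foldl-∷ʳ _▸_ e (bar s) (reflect p) ⟩
  foldl _▸_ e (reflect p) ▸ bar s    ≡⟨ cong (_▸ bar s) (foldl-reflect n (a ▸ s) p) ⟩
  mirror n (a ▸ s) ▸ bar s           ≡⟨ mirror-▸ n a s ⟩
  mirror n a                         ∎
  where
  open ≡-Reasoning
  e = mirror n (foldl _▸_ (a ▸ s) p)

mirror-vertices : ∀ n a p →
  map (mirror n) (reverse (verticesFrom a p)) ≡ verticesFrom (mirror n (foldl _▸_ a p)) (reflect p)
mirror-vertices n a []      = refl
mirror-vertices n a (s ∷ p) = begin
  map (mirror n) (reverse (a ∷ vs))             ≡⟨ cong (map (mirror n)) (unfold-reverse a vs) ⟩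
  map (mirror n) (reverse vs ∷ʳ a)              ≡⟨ map-++ (mirror n) (reverse vs) [ a ] ⟩
  map (mirror n) (reverse vs) ∷ʳ mirror n a     ≡⟨ cong₂ _∷ʳ_ (mirror-vertices n (a ▸ s) p) (sym (foldl-reflect n a (s ∷ p))) ⟩
  verticesFrom e (reflect p) ∷ʳ foldl _▸_ e (reflect (s ∷ p))
    ≡⟨ cong (λ q → verticesFrom e (reflect p) ∷ʳ foldl _▸_ e q) (reflect-∷ s p) ⟩
  verticesFrom e (reflect p) ∷ʳ foldl _▸_ e (reflect p ∷ʳ bar s)
    ≡⟨ verticesFrom-∷ʳ e (reflect p) (bar s) ⟨
  verticesFrom e (reflect p ∷ʳ bar s)           ≡⟨ cong (verticesFrom e) (reflect-∷ s p) ⟨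
  verticesFrom e (reflect (s ∷ p))              ∎
  where
  open ≡-Reasoning
  vs = verticesFrom (a ▸ s) p
  e  = mirror n (foldl _▸_ (a ▸ s) p)

module _ {n : ℕ} {p : List Step} (end : endpoint p ≡ (pos (2 ℕ.* n) , 0ℤ)) where

  private
    vertices-reflect : map (mirror n) (reverse (vertices p)) ≡ vertices (reflect p)
    vertices-reflect = trans (mirror-vertices n origin p) (cong (λ a → verticesFrom a (reflect p))
      (trans (cong (mirror n) end) (cong (_, 0ℤ) (ℤ.+-inverseʳ (pos (2 ℕ.* n))))))

  symmetric⇒reflect-invariant : IsSymmetric n p → reflect p ≡ p
  symmetric⇒reflect-invariant sym-p = verticesFrom-injective origin (reflect p) p (begin
    vertices (reflect p)                                ≡⟨ vertices-reflect ⟨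
    map (mirror n) (reverse (vertices p))               ≡⟨ cong (map (mirror n)) sym-p ⟨
    map (mirror n) (map (mirror n) (vertices p))        ≡⟨ map-involutive (mirror-involutive n) (vertices p) ⟩
    vertices p                                          ∎)
    where open ≡-Reasoning

  reflect-invariant⇒symmetric : reflect p ≡ p → IsSymmetric n p
  reflect-invariant⇒symmetric inv = begin
    map (mirror n) (vertices p)                         ≡⟨ cong (map (mirror n)) (reverse-involutive (vertices p)) ⟨
    map (mirror n) (reverse (reverse (vertices p)))     ≡⟨ reverse-map (mirror n) (reverse (vertices p)) ⟩
    reverse (map (mirror n) (reverse (vertices p)))     ≡⟨ cong reverse vertices-reflect ⟩
    reverse (vertices (reflect p))                      ≡⟨ cong (reverse ∘ vertices) inv ⟩
    reverse (vertices p)                                ∎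
    where open ≡-Reasoning

-- Integer heights and the endpoint of a merge

NonNegative : Point → Set
NonNegative a = 0ℤ ℤ.≤ proj₂ a

nonNegative⇒Above : ∀ a {k} → proj₂ a ≡ pos k → ∀ p → All NonNegative (verticesFrom a p) → Above k p
nonNegative⇒Above a y≡ [] _ = tt
nonNegative⇒Above a y≡ (h ∷ p) (_ ∷ ps) = nonNegative⇒Above (a ▸ h) y≡ p ps
nonNegative⇒Above a {k} refl (u ∷ p) (_ ∷ ps) = nonNegative⇒Above (a ▸ u) (cong pos (+-comm k 1)) p ps
nonNegative⇒Above a {suc k} refl (d ∷ p) (_ ∷ ps) = nonNegative⇒Above (a ▸ d) refl p ps
nonNegative⇒Above a {zero} refl (d ∷ p) (_ ∷ ps)
  with _ , eq ← verticesFrom-head (a ▸ d) p with () ∷ _ ← subst (All NonNegative) eq ps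

Above⇒nonNegative : ∀ a {k} → proj₂ a ≡ pos k → ∀ p → Above k p → All NonNegative (verticesFrom a p)
Above⇒nonNegative a refl [] _ = ℤ.+≤+ z≤n ∷ []
Above⇒nonNegative a refl (h ∷ p) above = ℤ.+≤+ z≤n ∷ Above⇒nonNegative (a ▸ h) refl p above
Above⇒nonNegative a {k} refl (u ∷ p) above = ℤ.+≤+ z≤n ∷ Above⇒nonNegative (a ▸ u) (cong pos (+-comm k 1)) p above
Above⇒nonNegative a {suc k} refl (d ∷ p) above = ℤ.+≤+ z≤n ∷ Above⇒nonNegative (a ▸ d) refl p above

-- The u's of `v` rise and those of `w` fall. For `w` the reversal of `v` the counts cancel, so the
-- path returns to the axis.
Merge-rise : ∀ a → Merge v w p → proj₂ (foldl _▸_ a p) ℤ.+ pos (count u w) ≡ proj₂ a ℤ.+ pos (count u v)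
Merge-rise a done = refl
Merge-rise a@(x , y) (down {v} {w} {p} m) = begin
  e ℤ.+ pos (count u (u ∷ w))                   ≡⟨ cong (λ k → e ℤ.+ pos k) (count-here u) ⟩
  e ℤ.+ (pos 1 ℤ.+ pos (count u w))               ≡⟨ swap e (pos (count u w)) ⟩
  pos 1 ℤ.+ (e ℤ.+ pos (count u w))               ≡⟨ cong (λ k → pos 1 ℤ.+ k) (Merge-rise (a ▸ d) m) ⟩
  pos 1 ℤ.+ ((y ℤ.- pos 1) ℤ.+ pos (count u v))     ≡⟨ cancel y (pos (count u v)) ⟩
  y ℤ.+ pos (count u v)                         ∎
  where
  open ≡-Reasoning
  e = proj₂ (foldl _▸_ (a ▸ d) p)
  swap : ∀ e k → e ℤ.+ (pos 1 ℤ.+ k) ≡ pos 1 ℤ.+ (e ℤ.+ k)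
  swap = solve-∀
  cancel : ∀ y k → pos 1 ℤ.+ ((y ℤ.- pos 1) ℤ.+ k) ≡ y ℤ.+ k
  cancel = solve-∀
Merge-rise a@(x , y) (up {v = v} _ m) = trans (Merge-rise (a ▸ u) m)
  (trans (ℤ.+-assoc y (pos 1) (pos (count u v))) (cong (λ k → y ℤ.+ pos k) (sym (count-here u))))
Merge-rise a@(x , y) (flat {v} {w} {p} m) = begin
  e ℤ.+ pos (count u (h ∷ w))  ≡⟨ cong (λ k → e ℤ.+ pos k) (count-other {u} {h} {w} λ ()) ⟩
  e ℤ.+ pos (count u w)        ≡⟨ Merge-rise (a ▸ h) m ⟩
  y ℤ.+ pos (count u v)        ≡⟨ cong (λ k → y ℤ.+ pos k) (count-other {u} {h} {v} λ ()) ⟨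
  y ℤ.+ pos (count u (h ∷ v))  ∎
  where
  open ≡-Reasoning
  e = proj₂ (foldl _▸_ (a ▸ h) p)
Merge-rise a@(x , y) (peak {v} {w} {p} m) = begin
  e ℤ.+ pos (count u (r ∷ w))                     ≡⟨ cong (λ k → e ℤ.+ pos k) (count-other {u} {r} {w} λ ()) ⟩
  e ℤ.+ pos (count u w)                           ≡⟨ Merge-rise (a ▸ u ▸ d) m ⟩
  ((y ℤ.+ pos 1) ℤ.- pos 1) ℤ.+ pos (count u v)   ≡⟨ cong (ℤ._+ pos (count u v)) (cancel y) ⟩
  y ℤ.+ pos (count u v)                           ≡⟨ cong (λ k → y ℤ.+ pos k) (count-other {u} {r} {v} λ ()) ⟨
  y ℤ.+ pos (count u (r ∷ v))                     ∎
  where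
  open ≡-Reasoning
  e = proj₂ (foldl _▸_ (a ▸ u ▸ d) p)
  cancel : ∀ y → (y ℤ.+ pos 1) ℤ.- pos 1 ≡ y
  cancel = solve-∀

-- Once the final height is 0, the abscissa is the coordinate sum, which the length of the
-- contraction gives.
Merge-endpoint : Merge v (reverse v) p → endpoint p ≡ (pos (2 ℕ.* length v) , 0ℤ)
Merge-endpoint {v} {p} m = cong₂ _,_ x≡ y≡
  where
  open ≡-Reasoning
  y≡ : proj₂ (endpoint p) ≡ 0ℤ
  y≡ = ℤ-group.∙-cancelʳ (pos (count u v)) _ _
         (trans (cong (λ k → proj₂ (endpoint p) ℤ.+ pos k) (sym (count-reverse u v))) (Merge-rise origin m))
  x≡ : proj₁ (endpoint p) ≡ pos (2 ℕ.* length v)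
  x≡ = begin
    proj₁ (endpoint p)                        ≡⟨ ℤ.+-identityʳ _ ⟨
    proj₁ (endpoint p) ℤ.+ 0ℤ                 ≡⟨ cong (λ y → proj₁ (endpoint p) ℤ.+ y) y≡ ⟨
    coordSum (endpoint p)                     ≡⟨ coordSum-foldl origin p ⟩
    0ℤ ℤ.+ pos 2 ℤ.* pos (length (contract p))      ≡⟨ ℤ.+-identityˡ _ ⟩
    pos 2 ℤ.* pos (length (contract p))             ≡⟨ ℤ.pos-* 2 (length (contract p)) ⟨
    pos (2 ℕ.* length (contract p))             ≡⟨ cong (λ v → pos (2 ℕ.* length v)) (Merge-contract m) ⟩
    pos (2 ℕ.* length v)                        ∎

-- Words of symmetric paths

record PathWord (v : List Letter) : Set where
  field
    balancedʳ : r-balanced v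
    balancedᵘ : u-balanced v

Sh⇒Merge : (p : Sh n) → Merge (contract (proj₁ p)) (reverse (contract (proj₁ p))) (proj₁ p)
Sh⇒Merge {n} (p , (end , _) , sym-p) = reflect-invariant⇒Merge (symmetric⇒reflect-invariant {n} {p} end sym-p)

Sh⇒PathWord : (p : Sh n) → PathWord (contract (proj₁ p))
Sh⇒PathWord {n} p = record
  { balancedʳ = palindrome⇒r-balanced {v = v₀} palindrome
  ; balancedᵘ = u-separated⇒u-balanced {v = v₀} palindrome
      (Climb⇒u-separated v₀ (Above⇒Climb merged
        (nonNegative⇒Above origin refl (proj₁ p) (proj₂ (proj₁ (proj₂ p))))))
  }
  where
  v₀ : List Letter
  v₀ = contract (proj₁ p)
  merged : Merge v₀ (reverse v₀) (proj₁ p)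
  merged = Sh⇒Merge {n} p
  palindrome : skeleton v₀ ≡ skeleton (reverse v₀)
  palindrome = Merge-skeleton merged

PathWord⇒Sh : length v ≡ n → PathWord v → Σ[ p ∈ Sh n ] contract (proj₁ p) ≡ v
PathWord⇒Sh {v} refl pw =
  (path , (end , Above⇒nonNegative origin refl path (Climb⇒Above merged (u-separated⇒Climb v separated))) ,
       reflect-invariant⇒symmetric {length v} {path} end (Merge⇒reflect-invariant merged)) ,
  Merge-contract merged
  where
  palindrome : skeleton v ≡ skeleton (reverse v)
  palindrome = r-balanced⇒palindrome v (PathWord.balancedʳ pw)
  separated : u-separated v
  separated = u-balanced⇒u-separated {v = v} palindrome (PathWord.balancedᵘ pw)
  path : List Step
  path = proj₁ (merge v (reverse v) palindrome)
  merged : Merge v (reverse v) path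
  merged = proj₂ (merge v (reverse v) palindrome)
  end : endpoint path ≡ (pos (2 ℕ.* length v) , 0ℤ)
  end = Merge-endpoint merged

letters-∷ʳ : ∀ p → letters p ≡ contract p ∷ʳ h
letters-∷ʳ p = contract-++ p λ ()

toList-word : (p : Sh n) → toList (word {n} p) ≡ contract (proj₁ p) ∷ʳ h
toList-word {n} p = trans (Vec.toList-cast (letters-length {n} p) (Vec.fromList (letters (proj₁ p))))
  (trans (Vec.toList∘fromList (letters (proj₁ p))) (letters-∷ʳ (proj₁ p)))

∷ʳ-split : ∀ v {z} α {β} → v ∷ʳ z ≡ α ++ x ∷ β → x ≢ z → ∃ λ β′ → β ≡ β′ ∷ʳ z × v ≡ α ++ x ∷ β′
∷ʳ-split v α {β} eq x≢z with initLast β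
... | []       = contradiction (sym (∷ʳ-injectiveʳ v α eq)) x≢z
... | β′ ∷ʳ′ y with refl , refl ← ∷ʳ-injective v (α ++ _ ∷ β′) (trans eq (sym (++-assoc α _ [ y ]))) =
  β′ , refl , refl

-- From path words to admissible words and back

module _ {c : Vec Letter m} {σ : Fin m → Fin m} (R : Reversal c σ) {v : List Letter} (c≡ : toList c ≡ v ∷ʳ h) where

  open Reversal R

  private
    count-∷ʳ-h : ∀ {x} β → x ≢ h → count x (β ∷ʳ h) ≡ count x β
    count-∷ʳ-h {x} β x≢h = trans (count-++ x β)
      (trans (cong (count x β +_) (trans (count-other (x≢h ∘ sym)) (count-nil x))) (ℕ.+-identityʳ _))

    count-h-∷ʳ-h : ∀ β → count h (β ∷ʳ h) ≡ suc (count h β)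
    count-h-∷ʳ-h β = trans (count-split h β) (cong suc (trans (cong (count h β +_) (count-nil h)) (ℕ.+-identityʳ _)))

    after-h : ∀ {i β} → after c i ≡ β ∷ʳ h → count h (after c i) ≡ suc (count h β)
    after-h {β = β} after≡ = trans (cong (count h) after≡) (count-h-∷ʳ-h β)

    after-r : ∀ {i β} → after c i ≡ β ∷ʳ h → count r (after c i) ≡ count r β
    after-r {β = β} after≡ = trans (cong (count r) after≡) (count-∷ʳ-h β λ ())

    interior : ∀ {i} → Vec.lookup c i ≡ x → x ≢ h → ∃ λ β → after c i ≡ β ∷ʳ h × v ≡ before c i ++ x ∷ β
    interior {i = i} refl x≢h = ∷ʳ-split v (before c i) (trans (sym c≡) (toList-split c i)) x≢h

    Mirrored⇒ : ∀ {P} → x ≢ h → Mirrored x P v → ∀ {i} → Vec.lookup c i ≡ x →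
                ∃ λ β → after c i ≡ β ∷ʳ h × P (before c (σ i)) β
    Mirrored⇒ {x = x} x≢h mir {i} ci with interior ci x≢h | interior (trans (keeps i) ci) x≢h
    ... | β , after≡ , v≡ | _ , _ , v≡′ = β , after≡ , mir v≡ v≡′
            (trans (flips ci) (trans (cong (count x) after≡) (count-∷ʳ-h β x≢h)))

    locate : ∀ α {β} → v ≡ α ++ x ∷ β → toList c ≡ α ++ x ∷ (β ∷ʳ h)
    locate {x = x} α {β} eq = trans c≡ (trans (cong (_∷ʳ h) eq) (++-assoc α (x ∷ β) [ h ]))

    -- The position of the second splitting has as many x's before it as i has after it, so it is
    -- `σ i`.
    ⇒Mirrored : ∀ {P : List Letter → List Letter → Set} → x ≢ h →
                (∀ {i β} → Vec.lookup c i ≡ x → after c i ≡ β ∷ʳ h → P (before c (σ i)) β) → Mirrored x P v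
    ⇒Mirrored {x = x} {P} x≢h at-i {α} {β} {α′} {β′} eq eq′ cx
      with i , at ci refl after≡  ← position c α (locate α eq)
         | j , at cj refl _ ← position c α′ (locate α′ eq′) =
      subst (λ k → P (before c k) β) (before-injective c (trans (keeps i) ci) cj
        (trans (flips ci) (trans (cong (count x) after≡) (trans (count-∷ʳ-h β x≢h) (sym cx)))))
        (at-i ci after≡)

  PathWord⇒Admissible : PathWord v → Admissible c σ
  PathWord⇒Admissible pw = record { r-count = r-count ; u-count = u-count }
    where
    open PathWord pw
    r-count : ∀ {i} → Vec.lookup c i ≡ r → count h (after c i) ≡ suc (count h (before c (σ i)))
    r-count ci with β , after≡ , eq ← Mirrored⇒ (λ ()) balancedʳ ci =
      trans (after-h after≡) (cong suc (sym eq))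
    u-count : ∀ {i} → Vec.lookup c i ≡ u →
      suc (count h (before c (σ i))) < count h (after c i) ⊎
      (count h (before c (σ i)) < count h (after c i) × count r (before c (σ i)) < count r (after c i))
    u-count {i} ci with Mirrored⇒ (λ ()) balancedᵘ ci
    ... | β , after≡ , inj₁ h< =
      inj₁ (subst (suc (count h (before c (σ i))) <_) (sym (after-h after≡)) (s<s h<))
    ... | β , after≡ , inj₂ (h≤ , r<) =
      inj₂ (subst (count h (before c (σ i)) <_) (sym (after-h after≡)) (s≤s h≤) ,
            subst (count r (before c (σ i)) <_) (sym (after-r after≡)) r<)

  Admissible⇒PathWord : Admissible c σ → PathWord v
  Admissible⇒PathWord adm = record
    { balancedʳ = ⇒Mirrored {P = λ α β → count h α ≡ count h β} (λ ()) λ ci after≡ →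
        suc-injective (trans (sym (r-count ci)) (after-h after≡))
    ; balancedᵘ = ⇒Mirrored
        {P = λ α β → count h α < count h β ⊎ (count h α ≤ count h β × count r α < count r β)} (λ ())
        λ {i} {β} ci after≡ → Sum.map
          (λ h< → ℕ.s<s⁻¹ (subst (suc (count h (before c (σ i))) <_) (after-h after≡) h<))
          (λ (h< , r<) → ℕ.s≤s⁻¹ (subst (count h (before c (σ i)) <_) (after-h after≡) h<) ,
                         subst (count r (before c (σ i)) <_) (after-r after≡) r<)
          (u-count ci)
    }
    where open Admissible adm

-- Nothing lies to the right of the last position, so no point dominates it.
labelling⇒last-h : ∀ (c : Vec Letter (suc n)) {σ} → Labelling c σ → ∃ λ v → toList c ≡ v ∷ʳ h
labelling⇒last-h c@(_ ∷ _) {σ} ℓ = last-h refl (initLast (toList c))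
  where
  last-h : ∀ {w} → toList c ≡ w → InitLast w → ∃ λ v → toList c ≡ v ∷ʳ h
  last-h () []
  last-h eq (v ∷ʳ′ x) with i , at ci _ after≡ ← position c v eq =
    v , trans eq (cong (v ∷ʳ_) (trans (sym ci) (Label-unique (ℓ i) (none λ j (i<j , _) →
      ℕ.n≮0 (subst (_ <_) (trans (cong (count _) after≡) (count-nil _)) (after-< c {j = j} refl i<j))))))

-- Injectivity and surjectivity of φ

◁-cong : ∀ {σ τ : Fin m → Fin m} → σ ≗ τ → ∀ {i j} → σ ⊢ i ◁ j → τ ⊢ i ◁ j
◁-cong σ≗τ {i} {j} (i<j , σi<σj) = i<j , subst₂ Fin._<_ (σ≗τ i) (σ≗τ j) σi<σj

Label-cong : ∀ {σ τ : Fin m → Fin m} {i} → σ ≗ τ → Label σ i x → Label τ i x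
Label-cong σ≗τ (none f)      = none λ j i◁j → f j (◁-cong (sym ∘ σ≗τ) i◁j)
Label-cong σ≗τ (one p only)  = one (◁-cong σ≗τ p) λ k i◁k → only k (◁-cong (sym ∘ σ≗τ) i◁k)
Label-cong σ≗τ (two j≢k p q) = two j≢k (◁-cong σ≗τ p) (◁-cong σ≗τ q)

-- Labels depend on the involution alone, so the word can be read off from it.
labelling-injective : ∀ {c c′ : Vec Letter m} {σ τ} → Labelling c σ → Labelling c′ τ → σ ≗ τ → c ≡ c′
labelling-injective {c = c} {c′} ℓ ℓ′ σ≗τ = begin
  c                            ≡⟨ Vec.tabulate∘lookup c ⟨
  Vec.tabulate (Vec.lookup c)  ≡⟨ Vec.tabulate-cong (λ i → Label-unique (Label-cong σ≗τ (ℓ i)) (ℓ′ i)) ⟩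
  Vec.tabulate (Vec.lookup c′) ≡⟨ Vec.tabulate∘lookup c′ ⟩
  c′                           ∎
  where open ≡-Reasoning

φ-reversal : (p : Sh n) → Reversal (word {n} p) (φ {n} p)
φ-reversal {n} p = reverseClasses-reversal (word {n} p)

φ-labelling : (p : Sh n) → Labelling (word {n} p) (φ {n} p)
φ-labelling {n} p = admissible⇒labelling (φ-reversal {n} p)
  (PathWord⇒Admissible (φ-reversal {n} p) (toList-word {n} p) (Sh⇒PathWord {n} p))

contract-injective : (p q : Sh n) → contract (proj₁ p) ≡ contract (proj₁ q) → _≈Sh_ {n} p q
contract-injective {n} p q eq = Merge-unique
  (subst (λ v → Merge v (reverse v) (proj₁ p)) eq (Sh⇒Merge {n} p))
  (Sh⇒Merge {n} q)

φ-injective : (p q : Sh n) → φ {n} p ≗ φ {n} q → _≈Sh_ {n} p q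
φ-injective {n} p q φp≗φq = contract-injective {n} p q (∷ʳ-injectiveˡ _ _ (begin
  contract (proj₁ p) ∷ʳ h  ≡⟨ toList-word {n} p ⟨
  toList (word {n} p)      ≡⟨ cong toList (labelling-injective (φ-labelling {n} p) (φ-labelling {n} q) φp≗φq) ⟩
  toList (word {n} q)      ≡⟨ toList-word {n} q ⟩
  contract (proj₁ q) ∷ʳ h  ∎))
  where open ≡-Reasoning

-- `Vec.cast` takes its length equation irrelevantly, so the proofs carried by a path do not affect
-- its word.
φ-cong : {p q : Sh n} → _≈Sh_ {n} p q → φ {n} p ≗ φ {n} q
φ-cong {p = _ , _} {_ , _} refl i = refl

-- π reverses the classes of its own word of labels; a path with that word has the same reversal, by
-- uniqueness.
φ-surjective : {π : Fin (suc n) → Fin (suc n)} → Involutive _≡_ π → Forkless π →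
               ∃ λ (p : Sh n) → φ {n} p ≗ π
φ-surjective {n} {π} inv forkless = preimage (labelling⇒last-h c labelling)
  where
  open ≡-Reasoning

  c : Vec Letter (suc n)
  c = Vec.tabulate (proj₁ ∘ label π)

  labelling : Labelling c π
  labelling i = subst (Label π i) (sym (Vec.lookup∘tabulate (proj₁ ∘ label π) i)) (proj₂ (label π i))

  reversal : Reversal c π
  reversal = forkless-involution⇒reversal inv forkless labelling

  length-≡ : ∀ v → toList c ≡ v ∷ʳ h → length v ≡ n
  length-≡ v c≡ = suc-injective (begin
    suc (length v)     ≡⟨ +-comm 1 (length v) ⟩
    length v + 1       ≡⟨ length-++ v ⟨
    length (v ∷ʳ h)    ≡⟨ cong length c≡ ⟨
    length (toList c)  ≡⟨ Vec.length-toList c ⟩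
    suc n              ∎)

  word-≡ : ∀ (p : Sh n) {v} → toList c ≡ v ∷ʳ h → contract (proj₁ p) ≡ v → word {n} p ≡ c
  word-≡ p {v} c≡ contract≡ = trans (sym (Vec.cast-is-id refl (word {n} p)))
    (Vec.toList-injective refl (word {n} p) c (begin
      toList (word {n} p)      ≡⟨ toList-word {n} p ⟩
      contract (proj₁ p) ∷ʳ h  ≡⟨ cong (_∷ʳ h) contract≡ ⟩
      v ∷ʳ h                   ≡⟨ c≡ ⟨
      toList c                 ∎))

  preimage : ∃ (λ v → toList c ≡ v ∷ʳ h) → ∃ λ (p : Sh n) → φ {n} p ≗ π
  preimage (v , c≡) =
    let pathWord      = Admissible⇒PathWord reversal c≡ (labelling⇒admissible reversal labelling)
        p , contract≡ = PathWord⇒Sh (length-≡ v c≡) pathWord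
    in p , Reversal-unique (subst (λ c → Reversal c (φ {n} p)) (word-≡ p c≡ contract≡) (φ-reversal {n} p))
                           reversal

theorem2p1 : ∀ (n : ℕ) →
    let T : List Pattern
        T = (1 ∷ 2 ∷ 3 ∷ 4 ∷ []) ∷ (1 ∷ 2 ∷ 4 ∷ 3 ∷ []) ∷ []
    in Σ[ wellDefined ∈ (∀ (p : Sh n) → Is𝓘 (suc n) T (φ p)) ]
         Bijective (_≈Sh_ {n}) (_≈𝓘_ {suc n} {T}) (λ p → φ p , wellDefined p)
theorem2p1 n = wellDefined , (λ {p} {q} → φ-injective {n} p q) , surjective
  where
  T : List Pattern
  T = 1234-pattern ∷ 1243-pattern ∷ []

  wellDefined : (p : Sh n) → Is𝓘 (suc n) T (φ p)
  wellDefined p = Reversal.involutive (φ-reversal {n} p) ,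
    forkless⇒avoids (labelling⇒forkless (φ-reversal {n} p) (φ-labelling {n} p))

  surjective : Surjective (_≈Sh_ {n}) (_≈𝓘_ {suc n} {T}) (λ p → φ p , wellDefined p)
  surjective (π , inv , avoids) =
    let p , φp≗π = φ-surjective {n} inv (avoids⇒forkless inv avoids)
    -- `Surjective` asks for the equation at every `q` equivalent to the preimage, hence `φ-cong`.
    in p , λ {q} q≈p i → trans (φ-cong {n} {q} {p} q≈p i) (φp≗π i)
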